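{- Let $n\ge 2$ be an integer and let $k=k(n)$ be the integer defined by $\sigma_k\le n<\sigma_{k+1}$. For every integer $j$ satisfying $1\le j\le k$ we have $$h_{j-1}(n)\le \frac56\, h_j(n),$$ and this inequality is an equality if and only if $j=k(n)\ge 2$ and ($n=\sigma_{j+1}-4$ or $n=\sigma_{j+1}-5$).
   Context: Let $p_i$ denote the $i$-th prime ($p_1=2$). Set $\sigma_0=0$ and $\sigma_j=p_1+p_2+\dots+p_j$ for $j\ge1$. For a squarefree positive integer $M$, $\ell(M)$ denotes the sum of the prime factors of $M$ (with $\ell(1)=0$) and $\omega(M)$ the number of prime factors of $M$. For an integer $n\ge 0$, $k(n)$ is the unique non-negative integer $k$ with $\sigma_k\le n<\sigma_{k+1}$. For $0\le j\le k(n)$ (equivalently $n\ge\sigma_j$), $h_j(n)$ is the maximum of all squarefree positive integers $M$ with $\omega(M)=j$ and $\ell(M)\le n$; in particular $h_0(n)=1$. -}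

module Defs where

open import Data.Empty using (⊥-elim)
open import Data.List.Base using (List; []; _∷_; _++_; filter; length; upTo)
open import Data.List.Extrema.Nat using (max; xs≤max; argmax-sel)
open import Data.List.Membership.Propositional using (_∈_)
open import Data.List.Membership.Propositional.Properties
  using (∈-∃++; ∈-filter⁺; ∈-filter⁻; ∈-upTo⁺)
open import Data.List.Relation.Binary.Permutation.Propositional
  using (_↭_; ↭-trans; ↭-reflexive; ↭⇒↭ₛ)
open import Data.List.Relation.Binary.Permutation.Propositional.Properties
  using (All-resp-↭; shift; ↭-length)
open import Data.List.Relation.Binary.Permutation.Setoid.Properties using (Unique-resp-↭)
open import Data.List.Relation.Unary.All as All using (All; []; _∷_)
open import Data.List.Relation.Unary.AllPairs using ([]; _∷_)
open import Data.List.Relation.Unary.Unique.Propositional using (Unique)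
open import Data.Nat
open import Data.Nat.Divisibility
open import Data.Nat.ListAction using (sum; product)
open import Data.Nat.ListAction.Properties using (sum-↭; product-↭)
open import Data.Nat.Primality
open import Data.Nat.Primality.Factorisation
open import Data.Nat.Properties
open import Data.Product using (_×_; _,_; proj₁; proj₂; ∃)
open import Data.Sum using (inj₁; inj₂)
open import Function using (id)
open import Relation.Binary.PropositionalEquality
  using (_≡_; refl; sym; trans; cong; subst; setoid)
open import Relation.Nullary using (¬_; yes; no; contradiction)
open import Relation.Nullary.Decidable using (map′; _×-dec_; _→-dec_)
open import Relation.Unary using (Pred; Decidable)
open import Level using (0ℓ)

open PrimeFactorisation

IsNextPrime : ℕ → ℕ → Set
IsNextPrime n q = Prime q × n < q × (∀ {r} → Prime r → n < r → q ≤ r)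

private
  primeFactor : ∀ m → 2 ≤ m → ∃ λ q → Prime q × q ∣ m
  primeFactor 1 (s≤s ())
  primeFactor m@(2+ _) _ with factorise m
  ... | record { factors = [] ; isFactorisation = () }
  ... | record { factors = q ∷ qs ; isFactorisation = eq ; factorsPrime = pr ∷ _ } =
    q , pr , divides (product qs) (trans eq (*-comm q (product qs)))

  ≤⇒∣! : ∀ {q n} → 1 ≤ q → q ≤ n → q ∣ n !
  ≤⇒∣! {suc q} _ q≤n = ∣-trans (m∣m*n (q !)) (m≤n⇒m!∣n! q≤n)

  1≤! : ∀ n → 1 ≤ n !
  1≤! zero    = ≤-refl
  1≤! (suc n) = *-mono-≤ (s≤s (z≤n {n})) (1≤! n)

  primeAbove : ∀ n → ∃ λ q → Prime q × n < q × q ≤ suc (n !)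
  primeAbove n with primeFactor (suc (n !)) (s≤s (1≤! n))
  ... | q , pr , q∣ = q , pr , ≰⇒> q≰n , ∣⇒≤ q∣
    where
    q≰n : ¬ q ≤ n
    q≰n q≤n = ¬prime[1] (subst Prime (∣1⇒≡1 q∣1) pr)
      where
      q∣n! : q ∣ n !
      q∣n! = ≤⇒∣! (>-nonZero⁻¹ q {{prime⇒nonZero pr}}) q≤n
      q∣1 : q ∣ 1
      q∣1 = ∣m+n∣m⇒∣n (subst (q ∣_) (sym (+-comm (n !) 1)) q∣) q∣n!

  search : ∀ n fuel m → n < m → (∀ {r} → Prime r → n < r → m ≤ r) →
           (∃ λ q → Prime q × n < q × q < m + fuel) → ∃ (IsNextPrime n)
  search n zero m _ low (q , pr , n<q , q<m+0) =
    ⊥-elim (<-irrefl refl (<-≤-trans (subst (q <_) (+-identityʳ m) q<m+0) (low pr n<q)))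
  search n (suc fuel) m n<m low (q , pr , n<q , q<) with prime? m
  ... | yes prm = m , prm , n<m , low
  ... | no ¬prm = search n fuel (suc m) (m<n⇒m<1+n n<m)
      (λ prr n<r → ≤∧≢⇒< (low prr n<r) (λ { refl → ¬prm prr }))
      (q , pr , n<q , subst (q <_) (+-suc m fuel) q<)

-- The search stops by n! + 1, whose prime factors all exceed n.
nextPrime : ∀ n → ∃ (IsNextPrime n)
nextPrime n = search n (suc (n !)) (suc n) ≤-refl (λ _ n<r → n<r) bound
  where
  bound : ∃ λ q → Prime q × n < q × q < suc n + suc (n !)
  bound with primeAbove n
  ... | q , pr , n<q , q≤ = q , pr , n<q , s≤s (≤-trans q≤ (m≤n+m (suc (n !)) n))

-- Indexed from 1, so p 1 ≡ 2; p 0 is not a prime but the starting point of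
-- the recursion.
p : ℕ → ℕ
p zero    = 0
p (suc i) = proj₁ (nextPrime (p i))

σ : ℕ → ℕ
σ zero    = 0
σ (suc j) = σ j + p (suc j)

-- Zero is not squarefree in this sense, so positivity is not a separate
-- condition.
Squarefree : Pred ℕ 0ℓ
Squarefree M = ∀ {d} → d * d ∣ M → d ≡ 1

-- Listed with multiplicity; for squarefree M these are the distinct prime
-- factors.  The value at 0 is arbitrary.
primeFactors : ℕ → List ℕ
primeFactors zero    = []
primeFactors (suc m) = factors (factorise (suc m))

ω : ℕ → ℕ
ω M = length (primeFactors M)

ℓ : ℕ → ℕ
ℓ M = sum (primeFactors M)

Admissible : ℕ → ℕ → Pred ℕ 0ℓ
Admissible j n M = Squarefree M × ω M ≡ j × ℓ M ≤ n

IsMaximum : Pred ℕ 0ℓ → ℕ → Set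
IsMaximum P m = P m × (∀ {M} → P M → M ≤ m)

squarefree? : Decidable Squarefree
squarefree? zero    = no λ sf → contradiction (sf {2} (4 ∣0)) λ ()
squarefree? M@(suc _) =
  map′ (λ f {d} dd∣M → f (s≤s (≤-trans (d≤d*d d) (∣⇒≤ dd∣M))) dd∣M)
       (λ sf {d} _ dd∣M → sf dd∣M)
       (allUpTo? (λ d → (d * d ∣? M) →-dec (d ≟ 1)) (suc M))
  where
  d≤d*d : ∀ d → d ≤ d * d
  d≤d*d zero      = z≤n
  d≤d*d d@(suc _) = m≤m*n d d

admissible? : ∀ j n → Decidable (Admissible j n)
admissible? j n M = squarefree? M ×-dec (ω M ≟ j) ×-dec (ℓ M ≤? n)

-- Every admissible M is at most 2 ^ n, since q ≤ 2 ^ q for each prime factor q;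
-- the search below is therefore exhaustive.  The value 0 is returned when no
-- M is admissible, which by h-isMaximum happens only for n < σ j.
h : ℕ → ℕ → ℕ
h j n = max 0 (filter (admissible? j n) (upTo (suc (2 ^ n))))

private
  n≤2^n : ∀ n → n ≤ 2 ^ n
  n≤2^n zero    = z≤n
  n≤2^n (suc n) = +-mono-≤ (m^n>0 2 n) (≤-trans (n≤2^n n) (m≤m+n (2 ^ n) 0))

  product≤2^sum : ∀ xs → product xs ≤ 2 ^ sum xs
  product≤2^sum []       = ≤-refl
  product≤2^sum (x ∷ xs) = subst (x * product xs ≤_)
    (sym (^-distribˡ-+-* 2 x (sum xs)))
    (*-mono-≤ (n≤2^n x) (product≤2^sum xs))

  admissible⇒≤ : ∀ {j n M} → Admissible j n M → M ≤ 2 ^ n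
  admissible⇒≤ {M = zero}  _ = z≤n
  admissible⇒≤ {n = n} {M = M@(suc _)} (_ , _ , ℓ≤n) = begin
    M                          ≡⟨ isFactorisation (factorise M) ⟩
    product (primeFactors M)   ≤⟨ product≤2^sum (primeFactors M) ⟩
    2 ^ ℓ M                    ≤⟨ ^-monoʳ-≤ 2 ℓ≤n ⟩
    2 ^ n                      ∎
    where open ≤-Reasoning

  squarefree-product : ∀ {xs} → All Prime xs → Unique xs → Squarefree (product xs)
  squarefree-product {xs} prs uniq {zero} 0∣ =
    contradiction (0∣⇒≡0 0∣) (≢-nonZero⁻¹ (product xs) {{productOfPrimes≢0 prs}})
  squarefree-product prs uniq {1} _ = refl
  squarefree-product {xs} prs uniq {d@(2+ _)} dd∣ = ⊥-elim absurd
    where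
    absurd : _
    absurd with primeFactor d (s≤s (s≤s z≤n))
    ... | q , pr , q∣d with ∈-∃++ (factorisationHasAllPrimeFactors pr
                              (∣-trans q∣d (∣-trans (m∣m*n d) dd∣)) prs)
    ... | ys , zs , eq = q∉ws (factorisationHasAllPrimeFactors pr q∣Πws
                                 (All.tail (All-resp-↭ perm prs)))
      where
      perm : xs ↭ q ∷ (ys ++ zs)
      perm = ↭-trans (↭-reflexive eq) (shift q ys zs)
      q∣Πws : q ∣ product (ys ++ zs)
      q∣Πws = *-cancelˡ-∣ q {{prime⇒nonZero pr}}
        (subst (q * q ∣_) (product-↭ perm) (∣-trans (*-pres-∣ q∣d q∣d) dd∣))
      q∉ws : ¬ q ∈ (ys ++ zs)
      q∉ws q∈ with Unique-resp-↭ (setoid ℕ) (↭⇒↭ₛ perm) uniq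
      ... | q≢ ∷ _ = All.lookup q≢ q∈ refl

  firstPrimes : ℕ → List ℕ
  firstPrimes zero    = []
  firstPrimes (suc j) = p (suc j) ∷ firstPrimes j

  firstPrimes-prime : ∀ j → All Prime (firstPrimes j)
  firstPrimes-prime zero    = []
  firstPrimes-prime (suc j) = proj₁ (proj₂ (nextPrime (p j))) ∷ firstPrimes-prime j

  p-mono : ∀ j → p j < p (suc j)
  p-mono j = proj₁ (proj₂ (proj₂ (nextPrime (p j))))

  firstPrimes-≤ : ∀ j → All (_≤ p j) (firstPrimes j)
  firstPrimes-≤ zero    = []
  firstPrimes-≤ (suc j) =
    ≤-refl ∷ All.map (λ x≤ → ≤-trans x≤ (<⇒≤ (p-mono j))) (firstPrimes-≤ j)

  firstPrimes-unique : ∀ j → Unique (firstPrimes j)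
  firstPrimes-unique zero    = []
  firstPrimes-unique (suc j) =
    All.map (λ x≤ eq → <⇒≢ (≤-<-trans x≤ (p-mono j)) (sym eq)) (firstPrimes-≤ j)
      ∷ firstPrimes-unique j

  firstPrimes-length : ∀ j → length (firstPrimes j) ≡ j
  firstPrimes-length zero    = refl
  firstPrimes-length (suc j) = cong suc (firstPrimes-length j)

  firstPrimes-sum : ∀ j → sum (firstPrimes j) ≡ σ j
  firstPrimes-sum zero    = refl
  firstPrimes-sum (suc j) =
    trans (cong (p (suc j) +_) (firstPrimes-sum j)) (+-comm (p (suc j)) (σ j))

  primeFactors-product : ∀ {xs} → All Prime xs → primeFactors (product xs) ↭ xs
  primeFactors-product {xs} prs = go (product xs) refl {{productOfPrimes≢0 prs}}
    where
    go : ∀ m → m ≡ product xs → .{{NonZero m}} → primeFactors m ↭ xs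
    go (suc m) eq = factorisationUnique (factorise (suc m))
      record { factors = xs ; isFactorisation = eq ; factorsPrime = prs }

  primorial-admissible : ∀ {j n} → σ j ≤ n → Admissible j n (product (firstPrimes j))
  primorial-admissible {j} {n} σ≤n =
      squarefree-product prs (firstPrimes-unique j)
    , trans (↭-length perm) (firstPrimes-length j)
    , subst (_≤ n) (sym (trans (sum-↭ perm) (firstPrimes-sum j))) σ≤n
    where
    prs  = firstPrimes-prime j
    perm = primeFactors-product prs

h-isMaximum : ∀ {j n} → σ j ≤ n → IsMaximum (Admissible j n) (h j n)
h-isMaximum {j} {n} σ≤n = attained , upper
  where
  candidates : List ℕ
  candidates = filter (admissible? j n) (upTo (suc (2 ^ n)))

  upper : ∀ {M} → Admissible j n M → M ≤ h j n
  upper adm = All.lookup (xs≤max 0 candidates)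
    (∈-filter⁺ (admissible? j n) (∈-upTo⁺ (s≤s (admissible⇒≤ adm))) adm)

  attained : Admissible j n (h j n)
  attained with argmax-sel id 0 candidates
  ... | inj₂ h∈ = proj₂ (∈-filter⁻ (admissible? j n) {xs = upTo (suc (2 ^ n))} h∈)
  ... | inj₁ h≡0 = contradiction
    (subst (product (firstPrimes j) ≤_) h≡0 (upper (primorial-admissible σ≤n)))
    (<⇒≱ (productOfPrimes≥1 (firstPrimes-prime j)))

{-# OPTIONS --safe #-}

-- Let S be a set of j − 1 primes with sum at most n, where σ j ≤ n; one looks for a set of j
-- primes with sum at most n and product at least 6/5 of that of S.  If 2 ∉ S, replace some
-- q ∈ S by 2 and the preceding prime, which is at least 3 q / 5; this is possible and gains
-- more than 6/5 unless S is {3, …, pⱼ}, to which 2 is added, or {5, …, pⱼ₊₁}, where the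
-- best exchange is 5 for {2, 3} if n < σ (j + 1) − 3.  If 2 ∈ S, discard the largest element q
-- repeatedly while the remaining sum allows; when it no longer does, S ∖ {q} is so close to
-- {p₁, …, pⱼ₋₁} that {p₁, …, pⱼ₋₁, r} wins, with r the largest prime that fits.
-- Both steps need a prime in (x, 5 x / 3].  It comes from Chebyshev's factorial ratio
-- (6n)! n! / ((3n)! (2n)! (2n)!), of size about 108ⁿ, which is divisible by every prime in
-- (2n, 6n] and whose prime powers are all at most 6n.
module Submission where

open import Defs

-- The constant 6/5 belongs to the trade of 5 for 2 and 3, which keeps the sum. In the even case,
-- passing from q to r may cost a factor close to 5/3, so a gain of 6/5 requires a factor of about 2
-- from replacing S without q by the initial primes. That factor is governed by the deficit D, the
-- amount by which the sum of S without q stays below that of the initial primes replacing it: it is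
-- at least D, but for D = 1 and D = 2 this is too little, and sharper bounds using 2 ∈ S are
-- needed. A central binomial coefficient would not give the prime gap: it confines the product of
-- the primes up to x between about 2^x and 4^x, hence yields primes only up to 2 x. Chebyshev's
-- ratio gives 108^(1/6) as base from below and, after iterating the step from 6n to 2n, 108^(1/4)
-- from above. The logarithms of these have quotient 3/2; with 10/3 in place of 108^(1/4) = 3.22...
-- the quotient is about 1.543, still below 5/3.

module Proof where

  open import Data.Bool.Base using (Bool; true; T; _∧_)
  open import Data.Bool.Properties using (T-∧)
  import Data.Integer as ℤ
  import Data.Integer.Properties as ℤ
  open import Data.List.Base using (List; []; _∷_; _++_; [_]; foldl; length)
  open import Data.List.Membership.Propositional using (_∈_)
  open import Data.List.Properties using (length-++)
  open import Data.List.Relation.Binary.Permutation.Propositional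
    using (_↭_; ↭-refl; ↭-trans; prep; swap)
  open import Data.List.Relation.Binary.Permutation.Propositional.Properties
    using (↭-length; ∈-resp-↭)
  open import Data.List.Relation.Unary.All as All using (All; []; _∷_)
  open import Data.List.Relation.Unary.Any as Any using (here; there)
  open import Data.List.Relation.Unary.Linked as Linked using (Linked; _∷_)
  open import Data.Nat
  open import Data.Nat.Divisibility
  open import Data.Nat.DivMod
  open import Data.Nat.Induction using (<-rec)
  open import Data.Nat.ListAction using (sum; product)
  open import Data.Nat.ListAction.Properties
    using (sum-++; product-++; sum-↭; product-↭; ∈⇒∣product)
  open import Data.Nat.Primality
  open import Data.Nat.Primality.Factorisation
  open import Data.Nat.Properties
  open import Data.Nat.Tactic.RingSolver using (solve-∀)
  open import Data.Product using (_×_; _,_; proj₁; proj₂; ∃)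
  import Data.Rational as ℚ
  open import Data.Rational.Literals using (fromℤ)
  import Data.Rational.Properties as ℚ
  import Data.Rational.Unnormalised as ℚᵘ
  import Data.Rational.Unnormalised.Properties as ℚᵘ
  open import Data.Sum using (_⊎_; inj₁; inj₂)
  open import Function using (_⇔_; mk⇔; Equivalence)
  open import Function.Construct.Composition using (_⇔-∘_)
  open import Relation.Binary.Definitions using (tri<; tri≈; tri>)
  open import Relation.Binary.PropositionalEquality hiding ([_])
  open import Relation.Nullary using (¬_; Dec; yes; no; contradiction)
  open import Relation.Nullary.Decidable
    using (from-yes; from-no; _×-dec_; _→-dec_; ¬?)
  open import Algebra.Properties.CommutativeSemigroup +-commutativeSemigroup
    using () renaming (interchange to +-interchange)
  open import Algebra.Properties.CommutativeSemigroup *-commutativeSemigroup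
    using (x∙yz≈y∙xz; xy∙z≈y∙xz) renaming (interchange to *-interchange)
  open import Data.List.Membership.DecPropositional _≟_ using (_∈?_)
  open PrimeFactorisation using (isFactorisation; factorsPrime)

  -- Legendre's formula

  -- A certificate for linear arithmetic: given `A ≤ B`, the identity Y - X = (B - A) + c settles
  -- the goal, and the identity is left to the ring solver.
  ≤-from-+ : ∀ {A B X Y} c → A ≤ B → Y + A ≡ X + B + c → X ≤ Y
  ≤-from-+ {A} {B} {X} {Y} c A≤B eq = +-cancelʳ-≤ A X Y (begin
    X + A      ≤⟨ +-monoʳ-≤ X A≤B ⟩
    X + B      ≤⟨ m≤m+n (X + B) c ⟩
    X + B + c  ≡⟨ eq ⟨
    Y + A      ∎)
    where open ≤-Reasoning

  ∑ : ℕ → (ℕ → ℕ) → ℕ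
  ∑ zero    f = 0
  ∑ (suc N) f = ∑ N f + f (suc N)

  ∏ : ℕ → (ℕ → ℕ) → ℕ
  ∏ zero    f = 1
  ∏ (suc N) f = ∏ N f * f (suc N)

  ∑-cong : ∀ N {f g : ℕ → ℕ} → (∀ i → 1 ≤ i → f i ≡ g i) → ∑ N f ≡ ∑ N g
  ∑-cong zero    eq = refl
  ∑-cong (suc N) eq = cong₂ _+_ (∑-cong N eq) (eq (suc N) z<s)

  ∑-mono : ∀ N {f g : ℕ → ℕ} → (∀ i → 1 ≤ i → f i ≤ g i) → ∑ N f ≤ ∑ N g
  ∑-mono zero    le = z≤n
  ∑-mono (suc N) le = +-mono-≤ (∑-mono N le) (le (suc N) z<s)

  ∑-+ : ∀ N (f g : ℕ → ℕ) → ∑ N (λ i → f i + g i) ≡ ∑ N f + ∑ N g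
  ∑-+ zero    f g = refl
  ∑-+ (suc N) f g rewrite ∑-+ N f g =
    +-interchange (∑ N f) (∑ N g) (f (suc N)) (g (suc N))

  ∑-zero : ∀ N {f : ℕ → ℕ} → (∀ i → 1 ≤ i → f i ≡ 0) → ∑ N f ≡ 0
  ∑-zero zero    eq = refl
  ∑-zero (suc N) eq = cong₂ _+_ (∑-zero N eq) (eq (suc N) z<s)

  ∑-shift : ∀ N (g : ℕ → ℕ) → ∑ N (λ i → g (i ∸ 1)) + g N ≡ g 0 + ∑ N g
  ∑-shift zero    g = sym (+-identityʳ (g 0))
  ∑-shift (suc N) g = trans (cong (_+ g (suc N)) (∑-shift N g)) (+-assoc (g 0) _ _)

  ∏-cong : ∀ N {f g : ℕ → ℕ} → (∀ i → 1 ≤ i → f i ≡ g i) → ∏ N f ≡ ∏ N g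
  ∏-cong zero    eq = refl
  ∏-cong (suc N) eq = cong₂ _*_ (∏-cong N eq) (eq (suc N) z<s)

  ∏-mono : ∀ N {f g : ℕ → ℕ} → (∀ i → 1 ≤ i → i ≤ N → f i ≤ g i) → ∏ N f ≤ ∏ N g
  ∏-mono zero    le = ≤-refl
  ∏-mono (suc N) le =
    *-mono-≤ (∏-mono N λ i 1≤i i≤N → le i 1≤i (m≤n⇒m≤1+n i≤N)) (le (suc N) z<s ≤-refl)

  ∏-* : ∀ N (f g : ℕ → ℕ) → ∏ N (λ i → f i * g i) ≡ ∏ N f * ∏ N g
  ∏-* zero    f g = refl
  ∏-* (suc N) f g rewrite ∏-* N f g =
    *-interchange (∏ N f) (∏ N g) (f (suc N)) (g (suc N))

  ∏-one : ∀ N {f : ℕ → ℕ} → (∀ i → 1 ≤ i → f i ≡ 1) → ∏ N f ≡ 1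
  ∏-one zero    eq = refl
  ∏-one (suc N) eq = cong₂ _*_ (∏-one N eq) (eq (suc N) z<s)

  ∏-split : ∀ M N {f g : ℕ → ℕ} → M ≤ N → (∀ i → i ≤ M → f i ≡ g i) →
            (∀ i → M < i → i ≤ N → f i ≡ 1) → ∏ N f ≡ ∏ M g
  ∏-split M N {f} {g} M≤N low high with m≤n⇒m<n∨m≡n M≤N
  ... | inj₂ refl = same M ≤-refl
    where
    same : ∀ L → L ≤ M → ∏ L f ≡ ∏ L g
    same zero    _   = refl
    same (suc L) L<M = cong₂ _*_ (same L (<⇒≤ L<M)) (low (suc L) L<M)
  ∏-split M (suc N) {f} {g} M≤N low high | inj₁ (s≤s M≤N′)
    rewrite high (suc N) (s≤s M≤N′) ≤-refl =
    trans (*-identityʳ (∏ N f))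
          (∏-split M N M≤N′ low λ i M<i i≤N → high i M<i (m≤n⇒m≤1+n i≤N))

  -- Division with the junk value n ÷ 0 = 0.
  infixl 7 _÷_
  _÷_ : ℕ → ℕ → ℕ
  n ÷ zero  = 0
  n ÷ suc d = n / suc d

  ÷-lower : ∀ n d → (n ÷ d) * d ≤ n
  ÷-lower n zero    = z≤n
  ÷-lower n (suc d) = m/n*n≤m n (suc d)

  ÷-upper : ∀ n {d} → 1 ≤ d → n < suc (n ÷ d) * d
  ÷-upper n {suc d} _ = subst (_< suc d + n / suc d * suc d) (sym (m≡m%n+[m/n]*n n (suc d)))
    (+-monoˡ-< (n / suc d * suc d) (m%n<n n (suc d)))

  ÷-unique : ∀ {n d} k → k * d ≤ n → n < suc k * d → n ÷ d ≡ k
  ÷-unique {n} {zero}  k _  hi = contradiction (subst (n <_) (*-zeroʳ k) hi) λ ()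
  ÷-unique {n} {suc d} k lo hi = ≤-antisym (s≤s⁻¹ (m<n*o⇒m/o<n hi))
    (subst (_≤ n / suc d) (m*n/n≡m k (suc d)) (/-monoˡ-≤ (suc d) lo))

  ÷-zero : ∀ {n d} → n < d → n ÷ d ≡ 0
  ÷-zero {n} {d} n<d = ÷-unique 0 z≤n (subst (n <_) (sym (*-identityˡ d)) n<d)

  ⟦_∣_⟧ : ℕ → ℕ → ℕ
  ⟦ d ∣ m ⟧ with d ∣? m
  ... | yes _ = 1
  ... | no  _ = 0

  ⟦∣⟧-cong : ∀ {d m e n} → (d ∣ m → e ∣ n) → (e ∣ n → d ∣ m) → ⟦ d ∣ m ⟧ ≡ ⟦ e ∣ n ⟧
  ⟦∣⟧-cong {d} {m} {e} {n} f g with d ∣? m | e ∣? n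
  ... | yes _ | yes _ = refl
  ... | yes x | no ¬y = contradiction (f x) ¬y
  ... | no ¬x | yes y = contradiction (g y) ¬x
  ... | no _  | no _  = refl

  ⟦∣⟧-no : ∀ {d m} → ¬ d ∣ m → ⟦ d ∣ m ⟧ ≡ 0
  ⟦∣⟧-no {d} {m} ¬x with d ∣? m
  ... | yes x = contradiction x ¬x
  ... | no _  = refl

  ⟦∣⟧-yes : ∀ {d m} → d ∣ m → ⟦ d ∣ m ⟧ ≡ 1
  ⟦∣⟧-yes {d} {m} x with d ∣? m
  ... | yes _ = refl
  ... | no ¬x = contradiction x ¬x

  ÷-suc : ∀ n {d} → 1 ≤ d → suc n ÷ d ≡ n ÷ d + ⟦ d ∣ suc n ⟧
  ÷-suc n {d} 1≤d with d ∣? suc n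
  ... | no ¬d∣ = trans (÷-unique (n ÷ d) (m≤n⇒m≤1+n (÷-lower n d))
      (≤∧≢⇒< (÷-upper n 1≤d) λ eq → ¬d∣ (divides (suc (n ÷ d)) eq)))
      (sym (+-identityʳ (n ÷ d)))
  ... | yes (divides c eq) = trans (÷-unique c (≤-reflexive (sym eq))
      (subst (_< suc c * d) (sym eq) (m<n+m (c * d) 1≤d)))
      (trans c≡ (+-comm 1 (n ÷ d)))
    where
    instance _ = >-nonZero 1≤d
    c≡ : c ≡ suc (n ÷ d)
    c≡ = ≤-antisym
      (*-cancelʳ-≤ c (suc (n ÷ d)) d (subst (_≤ suc (n ÷ d) * d) eq (÷-upper n 1≤d)))
      (*-cancelʳ-< d (n ÷ d) c (subst (n ÷ d * d <_) eq (s≤s (÷-lower n d))))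

  -- The value 1 at non-primes lets a product over the primes up to `N` run over all indices from 1
  -- to `N`.
  primeOr1 : ℕ → ℕ
  primeOr1 q with prime? q
  ... | yes _ = q
  ... | no  _ = 1

  primeOr1-¬prime : ∀ {q} → ¬ Prime q → primeOr1 q ≡ 1
  primeOr1-¬prime {q} ¬pr with prime? q
  ... | yes pr = contradiction pr ¬pr
  ... | no _   = refl

  prime≥2 : ∀ {q} → Prime q → 2 ≤ q
  prime≥2 {q} pr = nonTrivial⇒n>1 q {{prime⇒nonTrivial pr}}

  prime≥1 : ∀ {q} → Prime q → 1 ≤ q
  prime≥1 pr = <⇒≤ (prime≥2 pr)

  primeOr1≥1 : ∀ q → 1 ≤ primeOr1 q
  primeOr1≥1 q with prime? q
  ... | yes pr = prime≥1 pr
  ... | no _   = ≤-refl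

  n<2^n : ∀ n → n < 2 ^ n
  n<2^n zero    = ≤-refl
  n<2^n (suc n) = +-mono-≤-< (m^n>0 2 n) (subst (n <_) (sym (+-identityʳ (2 ^ n))) (n<2^n n))

  prime∣prime⇒≡ : ∀ {q r} → Prime q → Prime r → q ∣ r → q ≡ r
  prime∣prime⇒≡ prq prr q∣r with prime⇒irreducible prr q∣r
  ... | inj₁ refl = contradiction prq ¬prime[1]
  ... | inj₂ eq   = eq

  prime-power-∣-cancel : ∀ {q x} → Prime q → ¬ q ∣ x → ∀ i m → q ^ i ∣ x * m → q ^ i ∣ m
  prime-power-∣-cancel prq q∤x zero    m _ = 1∣ m
  prime-power-∣-cancel {q} {x} prq q∤x (suc i) m q∣
    with euclidsLemma x m prq (∣-trans (m∣m*n (q ^ i)) q∣)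
  ... | inj₁ q∣x = contradiction q∣x q∤x
  ... | inj₂ (divides m′ refl) = subst (q * q ^ i ∣_) (*-comm q m′)
    (*-monoʳ-∣ q (prime-power-∣-cancel prq q∤x i m′
      (*-cancelˡ-∣ q {{prime⇒nonZero prq}} (subst (q * q ^ i ∣_) (rotate x m′ q) q∣))))
    where
    rotate : ∀ a b c → a * (b * c) ≡ c * (a * b)
    rotate = solve-∀

  -- The exponent of `q` in `m`, cut off at `N`. Nothing is lost for prime `q` and `1 ≤ m ≤ N`,
  -- since `q ^ i` exceeds `m` for `i > N`.
  multiplicity : ℕ → ℕ → ℕ → ℕ
  multiplicity N q m = ∑ N λ i → ⟦ q ^ i ∣ m ⟧

  -- Records multiplication by the prime `x` inside a product over all indices.
  onlyAt : ℕ → ℕ → ℕ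
  onlyAt x q with q ≟ x
  ... | yes _ = x
  ... | no _  = 1

  ∏-onlyAt : ∀ N {x} → 1 ≤ x → x ≤ N → ∏ N (onlyAt x) ≡ x
  ∏-onlyAt zero    1≤x x≤0 = contradiction (≤-trans 1≤x x≤0) λ ()
  ∏-onlyAt (suc N) {x} 1≤x x≤N with suc N ≟ x
  ... | yes refl = trans (cong (_* suc N) (lower N ≤-refl)) (*-identityˡ (suc N))
    where
    lower : ∀ L → L ≤ N → ∏ L (onlyAt (suc N)) ≡ 1
    lower zero    _   = refl
    lower (suc L) L<N with suc L ≟ suc N
    ... | yes refl = contradiction L<N (<-irrefl refl)
    ... | no _     = cong (_* 1) (lower L (<⇒≤ L<N))
  ... | no ≢x    = trans (*-identityʳ _)
    (∏-onlyAt N 1≤x (s≤s⁻¹ (≤∧≢⇒< x≤N λ eq → ≢x (sym eq))))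

  -- `x ^ suc i` divides `x * m` exactly when `x ^ i` divides `m`, so the indicators shift by one
  -- place. The one pushed out at the top is 0 because `x ^ N > m`.
  multiplicity-*-same : ∀ N {x} m → Prime x → 1 ≤ m → m < 2 ^ N →
    multiplicity N x (x * m) ≡ 1 + multiplicity N x m
  multiplicity-*-same N {x} m prx 1≤m m<2^N = begin
    ∑ N (λ i → ⟦ x ^ i ∣ x * m ⟧)       ≡⟨ ∑-cong N shift ⟩
    ∑ N (λ i → g (i ∸ 1))               ≡⟨ +-identityʳ _ ⟨
    ∑ N (λ i → g (i ∸ 1)) + 0           ≡⟨ cong (∑ N (λ i → g (i ∸ 1)) +_) (⟦∣⟧-no top) ⟨
    ∑ N (λ i → g (i ∸ 1)) + g N         ≡⟨ ∑-shift N g ⟩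
    g 0 + ∑ N g                         ≡⟨ cong (_+ ∑ N g) (⟦∣⟧-yes (1∣ m)) ⟩
    1 + ∑ N g                           ∎
    where
    open ≡-Reasoning
    g : ℕ → ℕ
    g i = ⟦ x ^ i ∣ m ⟧
    shift : ∀ i → 1 ≤ i → ⟦ x ^ i ∣ x * m ⟧ ≡ g (i ∸ 1)
    shift (suc i) _ = ⟦∣⟧-cong (*-cancelˡ-∣ x {{prime⇒nonZero prx}}) (*-monoʳ-∣ x)
    top : ¬ x ^ N ∣ m
    top x^N∣m = <⇒≱ m<2^N (≤-trans (^-monoˡ-≤ N (prime≥2 prx)) (∣⇒≤ {{>-nonZero 1≤m}} x^N∣m))

  multiplicity-*-other : ∀ N {q x} m → Prime q → Prime x → q ≢ x →
    multiplicity N q (x * m) ≡ multiplicity N q m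
  multiplicity-*-other N {q} {x} m prq prx q≢x = ∑-cong N λ i _ →
    ⟦∣⟧-cong (prime-power-∣-cancel prq (λ q∣x → q≢x (prime∣prime⇒≡ prq prx q∣x)) i m)
             (∣n⇒∣m*n x)

  ∏-multiplicity-primes : ∀ N xs → All Prime xs → product xs ≤ N →
    ∏ N (λ q → primeOr1 q ^ multiplicity N q (product xs)) ≡ product xs
  ∏-multiplicity-primes N [] [] _ = ∏-one N pointwise
    where
    pointwise : ∀ q → 1 ≤ q → primeOr1 q ^ multiplicity N q 1 ≡ 1
    pointwise q _ with prime? q
    ... | no _   = ^-zeroˡ (multiplicity N q 1)
    ... | yes pr = cong (q ^_) (∑-zero N λ { (suc i) _ → ⟦∣⟧-no λ d →
      <⇒≢ (prime≥2 pr) (sym (∣1⇒≡1 (∣-trans (m∣m*n (q ^ i)) d))) })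
  ∏-multiplicity-primes N (x ∷ xs) (prx ∷ prs) x*m≤N = begin
    ∏ N (λ q → primeOr1 q ^ multiplicity N q (x * m))            ≡⟨ ∏-cong N pointwise ⟩
    ∏ N (λ q → primeOr1 q ^ multiplicity N q m * onlyAt x q)     ≡⟨ ∏-* N _ _ ⟩
    ∏ N (λ q → primeOr1 q ^ multiplicity N q m) * ∏ N (onlyAt x)
      ≡⟨ cong₂ _*_ (∏-multiplicity-primes N xs prs m≤N) (∏-onlyAt N (prime≥1 prx) x≤N) ⟩
    m * x                                                        ≡⟨ *-comm m x ⟩
    x * m                                                        ∎
    where
    open ≡-Reasoning
    m = product xs
    1≤m = productOfPrimes≥1 prs
    m≤N = ≤-trans (m≤n*m m x {{prime⇒nonZero prx}}) x*m≤N
    x≤N = ≤-trans (m≤m*n x m {{>-nonZero 1≤m}}) x*m≤N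
    pointwise : ∀ q → 1 ≤ q → primeOr1 q ^ multiplicity N q (x * m) ≡
                              primeOr1 q ^ multiplicity N q m * onlyAt x q
    pointwise q _ with prime? q | q ≟ x
    ... | no ¬pr | yes refl = contradiction prx ¬pr
    ... | no _   | no _ = trans (^-zeroˡ (multiplicity N q (x * m)))
      (sym (trans (*-identityʳ _) (^-zeroˡ (multiplicity N q m))))
    ... | yes _  | yes refl = trans
      (cong (x ^_) (multiplicity-*-same N m prx 1≤m (≤-<-trans m≤N (n<2^n N))))
      (*-comm x _)
    ... | yes pr | no q≢x = trans (cong (q ^_) (multiplicity-*-other N m pr prx q≢x))
      (sym (*-identityʳ _))

  ∏-multiplicity : ∀ N m → 1 ≤ m → m ≤ N →
    ∏ N (λ q → primeOr1 q ^ multiplicity N q m) ≡ m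
  ∏-multiplicity N m@(suc _) _ m≤N with factorise m
  ... | record { factors = xs ; isFactorisation = eq ; factorsPrime = prs }
    rewrite eq = ∏-multiplicity-primes N xs prs m≤N

  legendreExponent : ℕ → ℕ → ℕ → ℕ
  legendreExponent N n q = ∑ N λ i → n ÷ q ^ i

  -- Passing from `n` to `suc n` multiplies by the factorisation of `suc n`, and `n ÷ q ^ i` grows
  -- exactly when `q ^ i` divides `suc n`. The range `N` is independent of `n`, so that factorials
  -- of different sizes become products over the same indices.
  legendre : ∀ N n → n ≤ N → n ! ≡ ∏ N (λ q → primeOr1 q ^ legendreExponent N n q)
  legendre N zero _ = sym (∏-one N λ q 1≤q → cong (primeOr1 q ^_)
    (∑-zero N λ i _ → ÷-zero (m^n>0 q {{>-nonZero 1≤q}} i)))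
  legendre N (suc n) n<N = begin
    suc n * n !  ≡⟨ *-comm (suc n) (n !) ⟩
    n ! * suc n
      ≡⟨ cong₂ _*_ (legendre N n (<⇒≤ n<N)) (sym (∏-multiplicity N (suc n) z<s n<N)) ⟩
    ∏ N (λ q → primeOr1 q ^ legendreExponent N n q)
      * ∏ N (λ q → primeOr1 q ^ multiplicity N q (suc n))
      ≡⟨ ∏-* N _ _ ⟨
    ∏ N (λ q → primeOr1 q ^ legendreExponent N n q * primeOr1 q ^ multiplicity N q (suc n))
      ≡⟨ ∏-cong N pointwise ⟩
    ∏ N (λ q → primeOr1 q ^ legendreExponent N (suc n) q) ∎
    where
    open ≡-Reasoning
    pointwise : ∀ q → 1 ≤ q → _
    pointwise q 1≤q = trans
      (sym (^-distribˡ-+-* (primeOr1 q) (legendreExponent N n q) (multiplicity N q (suc n))))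
      (cong (primeOr1 q ^_) (trans (sym (∑-+ N _ _))
        (sym (∑-cong N λ i _ → ÷-suc n (m^n>0 q {{>-nonZero 1≤q}} i)))))

  -- Chebyshev's factorial ratio

  ⟦_≤_⟧ : ℕ → ℕ → ℕ
  ⟦ m ≤ n ⟧ with m ≤? n
  ... | yes _ = 1
  ... | no  _ = 0

  ÷-≤ : ∀ {k n d} → 1 ≤ d → k * d ≤ n → k ≤ n ÷ d
  ÷-≤ {k} {n} {d} 1≤d kd≤n = s≤s⁻¹ (*-cancelʳ-< d k (suc (n ÷ d)) (≤-<-trans kd≤n (÷-upper n 1≤d)))

  *-÷-≤ : ∀ k {n d} → 1 ≤ d → k * (n ÷ d) ≤ (k * n) ÷ d
  *-÷-≤ k {n} {d} 1≤d = ÷-≤ 1≤d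
    (subst (_≤ k * n) (sym (*-assoc k (n ÷ d) d)) (*-monoʳ-≤ k (÷-lower n d)))

  ÷-*-< : ∀ k {n d} .{{_ : NonZero k}} → 1 ≤ d → (k * n) ÷ d < k * suc (n ÷ d)
  ÷-*-< k {n} {d} 1≤d = *-cancelʳ-< d ((k * n) ÷ d) (k * suc (n ÷ d))
    (≤-<-trans (÷-lower (k * n) d)
      (subst (k * n <_) (sym (*-assoc k (suc (n ÷ d)) d)) (*-monoʳ-< k (÷-upper n 1≤d))))

  -- The quotients Z, B, A, C of n, 2n, 3n, 6n by d satisfy
  -- A + 2B ≤ C + Z ≤ A + 2B + 1: Chebyshev's observation for the factorial ratio
  -- (6n)! n! / ((3n)! (2n)! (2n)!).
  module Quotients (n d : ℕ) (1≤d : 1 ≤ d) where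
    Z = n ÷ d
    B = (2 * n) ÷ d
    A = (3 * n) ÷ d
    C = (6 * n) ÷ d

    2A≤C : 2 * A ≤ C
    2A≤C = subst (λ m → 2 * A ≤ m ÷ d) (sym (*-assoc 2 3 n)) (*-÷-≤ 2 1≤d)
    C<2A+2 : C < 2 * suc A
    C<2A+2 = subst (λ m → m ÷ d < 2 * suc A) (sym (*-assoc 2 3 n)) (÷-*-< 2 1≤d)
    3B≤C : 3 * B ≤ C
    3B≤C = subst (λ m → 3 * B ≤ m ÷ d) (sym (*-assoc 3 2 n)) (*-÷-≤ 3 1≤d)
    C<3B+3 : C < 3 * suc B
    C<3B+3 = subst (λ m → m ÷ d < 3 * suc B) (sym (*-assoc 3 2 n)) (÷-*-< 3 1≤d)
    3Z≤A : 3 * Z ≤ A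
    3Z≤A = *-÷-≤ 3 1≤d
    A<3Z+3 : A < 3 * suc Z
    A<3Z+3 = ÷-*-< 3 1≤d

    B-cases : B ≡ 2 * Z ⊎ B ≡ suc (2 * Z)
    B-cases with m≤n⇒m<n∨m≡n (*-÷-≤ 2 {n} {d} 1≤d)
    ... | inj₂ eq = inj₁ (sym eq)
    ... | inj₁ lt = inj₂ (≤-antisym (s≤s⁻¹ (subst (B <_) (*-suc 2 Z) (÷-*-< 2 1≤d))) lt)

    private
      arith₁ : ∀ a z c → c < 2 * suc a → a ≤ 3 * z → c + z ≤ a + 2 * (2 * z) + 1
      arith₁ a z c h₁ h₂ = ≤-from-+ 0 (+-mono-≤ h₁ h₂) (lem a z c)
        where
        lem : ∀ a z c → a + 2 * (2 * z) + 1 + (suc c + a) ≡ c + z + (2 * suc a + (3 * z)) + 0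
        lem = solve-∀
      arith₂ : ∀ a z c → c < 3 * suc (2 * z) → 3 * z < a → c + z ≤ a + 2 * (2 * z) + 1
      arith₂ a z c h₁ h₂ = ≤-from-+ 0 (+-mono-≤ h₁ h₂) (lem a z c)
        where
        lem : ∀ a z c → a + 2 * (2 * z) + 1 + (suc c + (suc (3 * z))) ≡ c + z + (3 * suc (2 * z) + a) + 0
        lem = solve-∀
      arith₃ : ∀ a z c → c < 2 * suc a → a < 3 * suc z → c + z ≤ a + 2 * suc (2 * z) + 1
      arith₃ a z c h₁ h₂ = ≤-from-+ 0 (+-mono-≤ h₁ h₂) (lem a z c)
        where
        lem : ∀ a z c → a + 2 * suc (2 * z) + 1 + (suc c + (suc a)) ≡ c + z + (2 * suc a + (3 * suc z)) + 0
        lem = solve-∀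
      arith₄ : ∀ a z c → 2 * a ≤ c → 3 * z ≤ a → a + 2 * (2 * z) ≤ c + z
      arith₄ a z c h₁ h₂ = ≤-from-+ 0 (+-mono-≤ h₁ h₂) (lem a z c)
        where
        lem : ∀ a z c → c + z + (2 * a + (3 * z)) ≡ a + 2 * (2 * z) + (c + a) + 0
        lem = solve-∀
      arith₅ : ∀ a z c → 3 * suc (2 * z) ≤ c → a ≤ 3 * z + 1 → a + 2 * suc (2 * z) ≤ c + z
      arith₅ a z c h₁ h₂ = ≤-from-+ 0 (+-mono-≤ h₁ h₂) (lem a z c)
        where
        lem : ∀ a z c → c + z + (3 * suc (2 * z) + a) ≡ a + 2 * suc (2 * z) + (c + (3 * z + 1)) + 0
        lem = solve-∀
      arith₆ : ∀ a z c → 2 * a ≤ c → 3 * z + 1 < a → a + 2 * suc (2 * z) ≤ c + z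
      arith₆ a z c h₁ h₂ = ≤-from-+ 0 (+-mono-≤ h₁ h₂) (lem a z c)
        where
        lem : ∀ a z c → c + z + (2 * a + (suc (3 * z + 1))) ≡ a + 2 * suc (2 * z) + (c + a) + 0
        lem = solve-∀

    -- `B` shows whether the fractional part of n / d reaches 1/2, and `A` whether it reaches 1/3 or
    -- 2/3. In each case two of the bounds above add up to the claim.
    upper : C + Z ≤ A + 2 * B + 1
    upper with B-cases | A ≤? 3 * Z
    ... | inj₁ eq | yes A≤ rewrite eq = arith₁ A Z C C<2A+2 A≤
    ... | inj₁ eq | no A≰ = subst (λ b → C + Z ≤ A + 2 * b + 1) (sym eq)
      (arith₂ A Z C (subst (λ b → C < 3 * suc b) eq C<3B+3) (≰⇒> A≰))
    ... | inj₂ eq | _ = subst (λ b → C + Z ≤ A + 2 * b + 1) (sym eq) (arith₃ A Z C C<2A+2 A<3Z+3)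

    lower : A + 2 * B ≤ C + Z
    lower with B-cases | A ≤? 3 * Z + 1
    ... | inj₁ eq | _ = subst (λ b → A + 2 * b ≤ C + Z) (sym eq) (arith₄ A Z C 2A≤C 3Z≤A)
    ... | inj₂ eq | yes A≤ = subst (λ b → A + 2 * b ≤ C + Z) (sym eq)
      (arith₅ A Z C (subst (λ b → 3 * b ≤ C) eq 3B≤C) A≤)
    ... | inj₂ eq | no A≰ = subst (λ b → A + 2 * b ≤ C + Z) (sym eq) (arith₆ A Z C 2A≤C (≰⇒> A≰))

    upper-⟦≤⟧ : C + Z ≤ A + 2 * B + ⟦ d ≤ 6 * n ⟧
    upper-⟦≤⟧ with d ≤? 6 * n
    ... | yes _ = upper
    ... | no d≰ = subst₂ (λ c z → c + z ≤ A + 2 * B + 0)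
      (sym (÷-zero (≰⇒> d≰))) (sym (÷-zero (≤-<-trans (m≤n*m n 6) (≰⇒> d≰)))) z≤n

    -- Here `B` is 0, and `C ≥ 1` with `C ≥ 2 * A` gives `C ≥ A + 1`. Taken at `d = q`, this is why
    -- every prime in (2n, 6n] divides the ratio.
    strict : 2 * n < d → d ≤ 6 * n → A + 2 * B + 1 ≤ C + Z
    strict 2n<d d≤6n = subst (λ b → A + 2 * b + 1 ≤ C + Z) (sym (÷-zero 2n<d)) (begin
      A + 0 + 1 ≡⟨ cong (_+ 1) (+-identityʳ A) ⟩
      A + 1     ≤⟨ A+1≤C A (÷-≤ 1≤d (subst (_≤ 6 * n) (sym (*-identityˡ d)) d≤6n)) 2A≤C ⟩
      C         ≤⟨ m≤m+n C Z ⟩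
      C + Z     ∎)
      where
      open ≤-Reasoning
      A+1≤C : ∀ a → 1 ≤ C → 2 * a ≤ C → a + 1 ≤ C
      A+1≤C zero    1≤C _    = 1≤C
      A+1≤C (suc a) _   2a≤C = ≤-trans (+-monoʳ-≤ (suc a) (s≤s z≤n)) 2a≤C

  2≤6 : 2 ≤ 6
  2≤6 = s≤s (s≤s z≤n)

  3≤6 : 3 ≤ 6
  3≤6 = s≤s (s≤s (s≤s z≤n))

  -- Kept apart so that the quotient is never formed: every estimate of the ratio is
  -- cross-multiplied.
  chebyshevNum chebyshevDen : ℕ → ℕ
  chebyshevNum n = (6 * n) ! * n !
  chebyshevDen n = (3 * n) ! * ((2 * n) ! * (2 * n) !)

  powersUpTo : ℕ → ℕ → ℕ
  powersUpTo N q = ∑ N λ i → ⟦ q ^ i ≤ N ⟧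

  numExponent denExponent : ℕ → ℕ → ℕ
  numExponent n q = ∑ (6 * n) λ i → (6 * n) ÷ q ^ i + n ÷ q ^ i
  denExponent n q = ∑ (6 * n) λ i → (3 * n) ÷ q ^ i + 2 * ((2 * n) ÷ q ^ i)

  ∏-^-+ : ∀ N (f g h : ℕ → ℕ) →
    ∏ N (λ q → f q ^ g q) * ∏ N (λ q → f q ^ h q) ≡ ∏ N (λ q → f q ^ (g q + h q))
  ∏-^-+ N f g h = trans (sym (∏-* N _ _))
    (∏-cong N λ q _ → sym (^-distribˡ-+-* (f q) (g q) (h q)))

  chebyshevNum-∏ : ∀ n → chebyshevNum n ≡ ∏ (6 * n) (λ q → primeOr1 q ^ numExponent n q)
  chebyshevNum-∏ n = trans
    (cong₂ _*_ (legendre (6 * n) (6 * n) ≤-refl) (legendre (6 * n) n (m≤n*m n 6)))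
    (trans (∏-^-+ N primeOr1 (legendreExponent N (6 * n)) (legendreExponent N n))
      (∏-cong N λ q _ → cong (primeOr1 q ^_)
        (sym (∑-+ N (λ i → (6 * n) ÷ q ^ i) (λ i → n ÷ q ^ i)))))
    where N = 6 * n

  chebyshevDen-∏ : ∀ n → chebyshevDen n ≡ ∏ (6 * n) (λ q → primeOr1 q ^ denExponent n q)
  chebyshevDen-∏ n = trans
    (cong₂ _*_ (legendre N (3 * n) (*-monoˡ-≤ n 3≤6))
      (trans (cong₂ _*_ leg₂ leg₂) (∏-^-+ N primeOr1 e₂ e₂)))
    (trans (∏-^-+ N primeOr1 e₃ (λ q → e₂ q + e₂ q))
      (∏-cong N λ q _ → cong (primeOr1 q ^_) (exponents q)))
    where
    N = 6 * n
    e₂ = legendreExponent N (2 * n)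
    e₃ = legendreExponent N (3 * n)
    leg₂ = legendre N (2 * n) (*-monoˡ-≤ n 2≤6)
    exponents : ∀ q → e₃ q + (e₂ q + e₂ q) ≡ denExponent n q
    exponents q = begin
      e₃ q + (e₂ q + e₂ q)                  ≡⟨ cong (e₃ q +_) (∑-+ N d₂ d₂) ⟨
      e₃ q + ∑ N (λ i → d₂ i + d₂ i)        ≡⟨ ∑-+ N (λ i → (3 * n) ÷ q ^ i) _ ⟨
      ∑ N (λ i → (3 * n) ÷ q ^ i + (d₂ i + d₂ i))
        ≡⟨ ∑-cong N (λ i _ → cong ((3 * n) ÷ q ^ i +_) (cong (d₂ i +_) (sym (+-identityʳ (d₂ i))))) ⟩
      denExponent n q                       ∎
      where
      open ≡-Reasoning
      d₂ : ℕ → ℕ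
      d₂ i = (2 * n) ÷ q ^ i

  q^i≥1 : ∀ {q} i → 1 ≤ q → 1 ≤ q ^ i
  q^i≥1 {q} i 1≤q = m^n>0 q {{>-nonZero 1≤q}} i

  primeOr1-^-mono : ∀ q {m n} → m ≤ n → primeOr1 q ^ m ≤ primeOr1 q ^ n
  primeOr1-^-mono q m≤n = ^-monoʳ-≤ (primeOr1 q) {{>-nonZero (primeOr1≥1 q)}} m≤n

  -- The product is lcm(1, ..., 6n), that is exp ψ(6n) for Chebyshev's function ψ: each prime power
  -- up to `6 * n` adds at most 1 to the exponent of its prime.
  chebyshev-upper : ∀ n → chebyshevNum n ≤
    chebyshevDen n * ∏ (6 * n) (λ q → primeOr1 q ^ powersUpTo (6 * n) q)
  chebyshev-upper n = begin
    chebyshevNum n                                      ≡⟨ chebyshevNum-∏ n ⟩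
    ∏ N (λ q → primeOr1 q ^ numExponent n q)
      ≤⟨ ∏-mono N (λ q 1≤q _ → primeOr1-^-mono q (exponents q 1≤q)) ⟩
    ∏ N (λ q → primeOr1 q ^ (denExponent n q + powersUpTo N q))
      ≡⟨ ∏-^-+ N primeOr1 (denExponent n) (powersUpTo N) ⟨
    ∏ N (λ q → primeOr1 q ^ denExponent n q) * ∏ N (λ q → primeOr1 q ^ powersUpTo N q)
      ≡⟨ cong (_* ∏ N (λ q → primeOr1 q ^ powersUpTo N q)) (chebyshevDen-∏ n) ⟨
    chebyshevDen n * ∏ N (λ q → primeOr1 q ^ powersUpTo N q)     ∎
    where
    open ≤-Reasoning
    N = 6 * n
    exponents : ∀ q → 1 ≤ q → numExponent n q ≤ denExponent n q + powersUpTo N q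
    exponents q 1≤q = subst (numExponent n q ≤_) (∑-+ N (λ i → (3 * n) ÷ q ^ i + 2 * ((2 * n) ÷ q ^ i)) (λ i → ⟦ q ^ i ≤ N ⟧))
      (∑-mono N λ i _ → Quotients.upper-⟦≤⟧ n (q ^ i) (q^i≥1 i 1≤q))

  -- The exponential of Chebyshev's function θ.
  θ̂ : ℕ → ℕ
  θ̂ x = ∏ x primeOr1

  θ̂-step : ∀ n → 1 ≤ n → chebyshevDen n * θ̂ (6 * n) ≤ chebyshevNum n * θ̂ (2 * n)
  θ̂-step n 1≤n = begin
    chebyshevDen n * θ̂ N                           ≡⟨ cong (chebyshevDen n *_) split ⟩
    chebyshevDen n * (∏ N above * θ̂ (2 * n))       ≡⟨ *-assoc (chebyshevDen n) (∏ N above) _ ⟨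
    chebyshevDen n * ∏ N above * θ̂ (2 * n)         ≤⟨ *-monoˡ-≤ (θ̂ (2 * n)) main ⟩
    chebyshevNum n * θ̂ (2 * n)                     ∎
    where
    open ≤-Reasoning
    N = 6 * n
    isAbove above below : ℕ → ℕ
    isAbove q with q ≤? 2 * n
    ... | yes _ = 0
    ... | no  _ = 1
    above q = primeOr1 q ^ isAbove q
    below q with q ≤? 2 * n
    ... | yes _ = primeOr1 q
    ... | no  _ = 1
    above*below : ∀ q → 1 ≤ q → primeOr1 q ≡ above q * below q
    above*below q _ with q ≤? 2 * n
    ... | yes _ = sym (*-identityˡ (primeOr1 q))
    ... | no  _ = sym (trans (*-identityʳ _) (*-identityʳ (primeOr1 q)))
    below-low : ∀ q → q ≤ 2 * n → below q ≡ primeOr1 q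
    below-low q q≤ with q ≤? 2 * n
    ... | yes _ = refl
    ... | no q≰ = contradiction q≤ q≰
    below-high : ∀ q → 2 * n < q → q ≤ N → below q ≡ 1
    below-high q q> _ with q ≤? 2 * n
    ... | yes q≤ = contradiction q≤ (<⇒≱ q>)
    ... | no _   = refl
    split : θ̂ N ≡ ∏ N above * θ̂ (2 * n)
    split = trans (∏-cong N above*below) (trans (∏-* N above below)
      (cong (∏ N above *_)
        (∏-split (2 * n) N (*-monoˡ-≤ n 2≤6) below-low below-high)))
    exponents : ∀ q → 1 ≤ q → q ≤ N → denExponent n q + isAbove q ≤ numExponent n q
    exponents q 1≤q q≤N with q ≤? 2 * n
    ... | yes _ = subst (_≤ numExponent n q) (sym (+-identityʳ _))
      (∑-mono N λ i _ → Quotients.lower n (q ^ i) (q^i≥1 i 1≤q))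
    ... | no q≰ = first N (*-mono-≤ {1} {6} (s≤s z≤n) 1≤n)
      where
      -- The surplus of 1 comes from `i = 1` alone, where `q` lies in (2n, 6n]; for the higher
      -- powers `Quotients.lower` is enough.
      first : ∀ K → 1 ≤ K → ∑ K (λ i → (3 * n) ÷ q ^ i + 2 * ((2 * n) ÷ q ^ i)) + 1 ≤
                            ∑ K (λ i → (6 * n) ÷ q ^ i + n ÷ q ^ i)
      first 1 _ = Quotients.strict n (q ^ 1) (q^i≥1 1 1≤q)
        (subst (2 * n <_) (sym (*-identityʳ q)) (≰⇒> q≰)) (subst (_≤ N) (sym (*-identityʳ q)) q≤N)
      first (suc K@(suc _)) _ = begin
        S + s + 1   ≡⟨ +-assoc S s 1 ⟩
        S + (s + 1) ≡⟨ cong (S +_) (+-comm s 1) ⟩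
        S + (1 + s) ≡⟨ +-assoc S 1 s ⟨
        S + 1 + s   ≤⟨ +-mono-≤ (first K z<s) (Quotients.lower n (q ^ suc K) (q^i≥1 (suc K) 1≤q)) ⟩
        _           ∎
        where
        S = ∑ K (λ i → (3 * n) ÷ q ^ i + 2 * ((2 * n) ÷ q ^ i))
        s = (3 * n) ÷ q ^ suc K + 2 * ((2 * n) ÷ q ^ suc K)
    main : chebyshevDen n * ∏ N above ≤ chebyshevNum n
    main = begin
      chebyshevDen n * ∏ N above                       ≡⟨ cong (_* ∏ N above) (chebyshevDen-∏ n) ⟩
      ∏ N (λ q → primeOr1 q ^ denExponent n q) * ∏ N above  ≡⟨ ∏-^-+ N primeOr1 (denExponent n) isAbove ⟩
      ∏ N (λ q → primeOr1 q ^ (denExponent n q + isAbove q))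
        ≤⟨ ∏-mono N (λ q 1≤q q≤N → primeOr1-^-mono q (exponents q 1≤q q≤N)) ⟩
      ∏ N (λ q → primeOr1 q ^ numExponent n q)         ≡⟨ chebyshevNum-∏ n ⟨
      chebyshevNum n                                   ∎

  -- The ratio chebyshevNum n / chebyshevDen n grows by the factor 108 stepNum n / stepDen n.
  stepCommon stepNum stepDen : ℕ → ℕ
  stepCommon n = 24 * ((3 + 3 * n) * (2 + 3 * n) * (1 + 3 * n) * ((1 + 2 * n) * (1 + n)))
  stepNum n = (1 + 6 * n) * (5 + 6 * n)
  stepDen n = 18 * ((1 + 2 * n) * (1 + n))

  [6+m]! : ∀ m → (6 + m) ! ≡ (6 + m) * ((5 + m) * ((4 + m) * ((3 + m) * ((2 + m) * ((1 + m) * m !)))))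
  [6+m]! m = refl
  [3+m]! : ∀ m → (3 + m) ! ≡ (3 + m) * ((2 + m) * ((1 + m) * m !))
  [3+m]! m = refl
  [2+m]! : ∀ m → (2 + m) ! ≡ (2 + m) * ((1 + m) * m !)
  [2+m]! m = refl

  num-suc : ∀ n → chebyshevNum (suc n) ≡ stepCommon n * stepNum n * chebyshevNum n
  num-suc n = trans
    (cong (_* suc n !) (trans (cong _! (*-suc 6 n)) ([6+m]! (6 * n))))
    (lem n ((6 * n) !) (n !))
    where
    lem : ∀ n x y → (6 + 6 * n) * ((5 + 6 * n) * ((4 + 6 * n) * ((3 + 6 * n) *
      ((2 + 6 * n) * ((1 + 6 * n) * x))))) * ((1 + n) * y) ≡
      24 * ((3 + 3 * n) * (2 + 3 * n) * (1 + 3 * n) * ((1 + 2 * n) * (1 + n))) *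
       ((1 + 6 * n) * (5 + 6 * n)) * (x * y)
    lem = solve-∀

  den-suc : ∀ n → 108 * chebyshevDen (suc n) ≡ stepCommon n * stepDen n * chebyshevDen n
  den-suc n = trans
    (cong (108 *_) (cong₂ _*_ (trans (cong _! (*-suc 3 n)) ([3+m]! (3 * n)))
                              (cong₂ _*_ e₂ e₂)))
    (lem n ((3 * n) !) ((2 * n) !))
    where
    e₂ = trans (cong _! (*-suc 2 n)) ([2+m]! (2 * n))
    lem : ∀ n x y → 108 * ((3 + 3 * n) * ((2 + 3 * n) * ((1 + 3 * n) * x)) *
      ((2 + 2 * n) * ((1 + 2 * n) * y) * ((2 + 2 * n) * ((1 + 2 * n) * y)))) ≡
      24 * ((3 + 3 * n) * (2 + 3 * n) * (1 + 3 * n) * ((1 + 2 * n) * (1 + n))) *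
       (18 * ((1 + 2 * n) * (1 + n))) * (x * (y * y))
    lem = solve-∀

  stepNum≤stepDen : ∀ n → stepNum n ≤ stepDen n
  stepNum≤stepDen n = subst (stepNum n ≤_) (lem n) (m≤m+n (stepNum n) (18 * n + 13))
    where
    lem : ∀ n → (1 + 6 * n) * (5 + 6 * n) + (18 * n + 13) ≡ 18 * ((1 + 2 * n) * (1 + n))
    lem = solve-∀

  -- At index n the ratio grows by 108 times about 1 - 1/(2n). The weaker (n + 1)/(n + 2)
  -- telescopes, which is the origin of the factor `2 * suc n` in `chebyshevNum≥`. It fails at index
  -- 0, hence the shift to `suc n`.
  stepDen≤stepNum : ∀ n → stepDen (suc n) * (2 + n) ≤ stepNum (suc n) * (3 + n)
  stepDen≤stepNum n = subst (stepDen (suc n) * (2 + n) ≤_) (lem n)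
    (m≤m+n (stepDen (suc n) * (2 + n)) (15 + n * (41 + 18 * n)))
    where
    lem : ∀ n → 18 * ((1 + 2 * (1 + n)) * (2 + n)) * (2 + n) + (15 + n * (41 + 18 * n))
      ≡ (1 + 6 * (1 + n)) * (5 + 6 * (1 + n)) * (3 + n)
    lem = solve-∀

  chebyshevNum≤ : ∀ n → chebyshevNum n ≤ 108 ^ n * chebyshevDen n
  chebyshevNum≤ zero    = ≤-refl
  chebyshevNum≤ (suc n) = begin
    chebyshevNum (suc n)                              ≡⟨ num-suc n ⟩
    stepCommon n * stepNum n * chebyshevNum n
      ≤⟨ *-mono-≤ (*-monoʳ-≤ (stepCommon n) (stepNum≤stepDen n)) (chebyshevNum≤ n) ⟩
    stepCommon n * stepDen n * (108 ^ n * chebyshevDen n)    ≡⟨ x∙yz≈y∙xz (stepCommon n * stepDen n) (108 ^ n) (chebyshevDen n) ⟩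
    108 ^ n * (stepCommon n * stepDen n * chebyshevDen n)    ≡⟨ cong (108 ^ n *_) (den-suc n) ⟨
    108 ^ n * (108 * chebyshevDen (suc n))            ≡⟨ lem (108 ^ n) 108 (chebyshevDen (suc n)) ⟩
    108 * 108 ^ n * chebyshevDen (suc n)              ∎
    where
    open ≤-Reasoning
    lem : ∀ a b c → a * (b * c) ≡ b * a * c
    lem = solve-∀

  chebyshevNum≥ : ∀ n → 1 ≤ n → 108 ^ n * chebyshevDen n ≤ 2 * suc n * chebyshevNum n
  chebyshevNum≥ 1 _ = from-yes (108 ^ 1 * chebyshevDen 1 ≤? 2 * 2 * chebyshevNum 1)
  chebyshevNum≥ (suc n@(suc n′)) _ = *-cancelʳ-≤ _ _ (suc n) (begin
    108 * 108 ^ n * chebyshevDen (suc n) * suc n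
      ≡⟨ lem₁ 108 (108 ^ n) (chebyshevDen (suc n)) (suc n) ⟩
    108 ^ n * (108 * chebyshevDen (suc n)) * suc n
      ≡⟨ cong (λ z → 108 ^ n * z * suc n) (den-suc n) ⟩
    108 ^ n * (stepCommon n * stepDen n * chebyshevDen n) * suc n
      ≡⟨ lem₂ (108 ^ n) (stepCommon n) (stepDen n) (chebyshevDen n) (suc n) ⟩
    stepCommon n * (stepDen n * suc n) * (108 ^ n * chebyshevDen n)
      ≤⟨ *-mono-≤ (*-monoʳ-≤ (stepCommon n) (stepDen≤stepNum n′)) (chebyshevNum≥ n z<s) ⟩
    stepCommon n * (stepNum n * (2 + n)) * (2 * suc n * chebyshevNum n)
      ≡⟨ lem₃ (stepCommon n) (stepNum n) (2 + n) 2 (suc n) (chebyshevNum n) ⟩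
    2 * (2 + n) * (stepCommon n * stepNum n * chebyshevNum n) * suc n
      ≡⟨ cong (λ z → 2 * (2 + n) * z * suc n) (num-suc n) ⟨
    2 * (2 + n) * chebyshevNum (suc n) * suc n  ∎)
    where
    open ≤-Reasoning
    lem₁ : ∀ a b c d → a * b * c * d ≡ b * (a * c) * d
    lem₁ = solve-∀
    lem₂ : ∀ a b c d e → a * (b * c * d) * e ≡ b * (c * e) * (a * d)
    lem₂ = solve-∀
    lem₃ : ∀ a b c d e f → a * (b * c) * (d * e * f) ≡ d * c * (a * b * f) * e
    lem₃ = solve-∀

  -- An upper bound for the product of the primes up to x

  θ̂-mono : ∀ {x y} → x ≤ y → θ̂ x ≤ θ̂ y
  θ̂-mono {x} {zero}  z≤n = ≤-refl
  θ̂-mono {x} {suc y} x≤y with m≤n⇒m<n∨m≡n x≤y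
  ... | inj₂ refl = ≤-refl
  ... | inj₁ x<y  = ≤-trans (θ̂-mono (s≤s⁻¹ x<y))
    (m≤m*n (θ̂ y) (primeOr1 (suc y)) {{>-nonZero (primeOr1≥1 (suc y))}})

  chebyshevDen≢0 : ∀ n → NonZero (chebyshevDen n)
  chebyshevDen≢0 n = m*n≢0 ((3 * n) !) _ {{(3 * n) !≢0}}
    {{m*n≢0 ((2 * n) !) ((2 * n) !) {{(2 * n) !≢0}} {{(2 * n) !≢0}}}}

  θ̂[6n]≤ : ∀ n → 1 ≤ n → θ̂ (6 * n) ≤ 108 ^ n * θ̂ (2 * n)
  θ̂[6n]≤ n 1≤n = *-cancelˡ-≤ (chebyshevDen n) {{chebyshevDen≢0 n}} (begin
    chebyshevDen n * θ̂ (6 * n)                ≤⟨ θ̂-step n 1≤n ⟩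
    chebyshevNum n * θ̂ (2 * n)                ≤⟨ *-monoˡ-≤ (θ̂ (2 * n)) (chebyshevNum≤ n) ⟩
    108 ^ n * chebyshevDen n * θ̂ (2 * n)      ≡⟨ xy∙z≈y∙xz (108 ^ n) (chebyshevDen n) (θ̂ (2 * n)) ⟩
    chebyshevDen n * (108 ^ n * θ̂ (2 * n))    ∎)
    where open ≤-Reasoning

  -- The running product `t` is `θ̂ x`, so each step costs one primality test, and a Boolean lets
  -- all small cases be settled by a single computation.
  θ̂-boundedFrom : (fuel x t : ℕ) → Bool
  θ̂-boundedFrom zero       x t = true
  θ̂-boundedFrom (suc fuel) x t =
    (3 ^ x * t ≤ᵇ 10 ^ x) ∧ θ̂-boundedFrom fuel (suc x) (t * primeOr1 (suc x))

  θ̂-boundedFrom-sound : ∀ fuel x → T (θ̂-boundedFrom fuel x (θ̂ x)) →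
    ∀ i → i < fuel → 3 ^ (x + i) * θ̂ (x + i) ≤ 10 ^ (x + i)
  θ̂-boundedFrom-sound (suc fuel) x ok i i< with Equivalence.to (T-∧ {3 ^ x * θ̂ x ≤ᵇ 10 ^ x}) ok
  θ̂-boundedFrom-sound (suc fuel) x ok zero    i< | now , _
    rewrite +-identityʳ x = ≤ᵇ⇒≤ _ _ now
  θ̂-boundedFrom-sound (suc fuel) x ok (suc i) (s≤s i<) | _ , later
    rewrite +-suc x i = θ̂-boundedFrom-sound fuel (suc x) later i i<

  -- (3/10)⁶ 108 (10/3)² = 8748/10000 per unit of m; 360 collects the boundary terms.
  growth : ∀ i → 8748 ^ (i + 45) * 360 ≤ 10000 ^ (i + 45)
  growth zero    = from-yes (8748 ^ 45 * 360 ≤? 10000 ^ 45)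
  growth (suc i) = begin
    8748 * 8748 ^ (i + 45) * 360     ≡⟨ *-assoc 8748 (8748 ^ (i + 45)) 360 ⟩
    8748 * (8748 ^ (i + 45) * 360)   ≤⟨ *-mono-≤ (from-yes (8748 ≤? 10000)) (growth i) ⟩
    10000 * 10000 ^ (i + 45)         ∎
    where open ≤-Reasoning

  -- Strong induction from x to about x / 3. Rounding x up to a multiple of 6 costs a constant
  -- factor, which the slack between 108^(1/4) and 10/3 absorbs from 271 on; smaller x are
  -- evaluated.
  θ̂-bound : ∀ x → 3 ^ x * θ̂ x ≤ 10 ^ x
  θ̂-bound = <-rec _ bound
    where
    open ≤-Reasoning
    small : ∀ i → i < 271 → 3 ^ i * θ̂ i ≤ 10 ^ i
    small = θ̂-boundedFrom-sound 271 0 _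

    regroup : ∀ m → 8748 ^ m ≡ (3 ^ m) * (3 ^ m) * (3 ^ m) * (3 ^ m) * 108 ^ m
    regroup zero    = refl
    regroup (suc m) = trans (cong (8748 *_) (regroup m)) (lem (3 ^ m) (108 ^ m))
      where
      lem : ∀ a b → 8748 * (a * a * a * a * b) ≡ (3 * a) * (3 * a) * (3 * a) * (3 * a) * (108 * b)
      lem = solve-∀

    regroup′ : ∀ m → 10000 ^ m ≡ (10 ^ m) * (10 ^ m) * (10 ^ m) * (10 ^ m)
    regroup′ zero    = refl
    regroup′ (suc m) = trans (cong (10000 *_) (regroup′ m)) (lem (10 ^ m))
      where
      lem : ∀ a → 10000 * (a * a * a * a) ≡ (10 * a) * (10 * a) * (10 * a) * (10 * a)
      lem = solve-∀

    2* : ∀ a m → a ^ (2 * m) ≡ a ^ m * a ^ m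
    2* a m = trans (cong (a ^_) (cong (m +_) (+-identityʳ m))) (^-distribˡ-+-* a m m)

    6* : ∀ a m → a ^ (6 * m) ≡ (a ^ m * a ^ m) * (a ^ m * a ^ m) * (a ^ m * a ^ m)
    6* a m = trans (cong (a ^_) (lem m))
      (trans (^-distribˡ-+-* a (2 * m + 2 * m) (2 * m))
        (cong₂ _*_ (trans (^-distribˡ-+-* a (2 * m) (2 * m)) (cong₂ _*_ (2* a m) (2* a m))) (2* a m)))
      where
      lem : ∀ m → 6 * m ≡ (2 * m + 2 * m) + 2 * m
      lem = solve-∀

    large : ∀ i → let m = i + 45 in
      3 ^ (1 + 6 * m) * 108 ^ suc m * 10 ^ (2 * suc m) ≤ 3 ^ (2 * suc m) * 10 ^ (1 + 6 * m)
    large i = begin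
      3 ^ (1 + 6 * m) * 108 ^ suc m * 10 ^ (2 * suc m)
        ≡⟨ cong₂ (λ u v → 3 * u * 108 ^ suc m * v) (6* 3 m) (2* 10 (suc m)) ⟩
      3 * ((a * a) * (a * a) * (a * a)) * (108 * b) * ((10 * c) * (10 * c))
        ≡⟨ lem₁ a b c ⟩
      (a * a * a * a * b) * 360 * (90 * a * a * c * c)
        ≡⟨ cong (λ u → u * 360 * (90 * a * a * c * c)) (regroup m) ⟨
      8748 ^ m * 360 * (90 * a * a * c * c)
        ≤⟨ *-monoˡ-≤ (90 * a * a * c * c) (growth i) ⟩
      10000 ^ m * (90 * a * a * c * c)
        ≡⟨ cong (_* (90 * a * a * c * c)) (regroup′ m) ⟩
      c * c * c * c * (90 * a * a * c * c)
        ≡⟨ lem₂ a c ⟩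
      (3 * a) * (3 * a) * (10 * ((c * c) * (c * c) * (c * c)))
        ≡⟨ cong₂ (λ u v → u * (10 * v)) (2* 3 (suc m)) (6* 10 m) ⟨
      3 ^ (2 * suc m) * 10 ^ (1 + 6 * m) ∎
      where
      m = i + 45
      a = 3 ^ m
      b = 108 ^ m
      c = 10 ^ m
      lem₁ : ∀ a b c → 3 * ((a * a) * (a * a) * (a * a)) * (108 * b) * ((10 * c) * (10 * c)) ≡
        (a * a * a * a * b) * 360 * (90 * a * a * c * c)
      lem₁ = solve-∀
      lem₂ : ∀ a c → c * c * c * c * (90 * a * a * c * c) ≡
        (3 * a) * (3 * a) * (10 * ((c * c) * (c * c) * (c * c)))
      lem₂ = solve-∀

    bound : ∀ x → (∀ {y} → y < x → 3 ^ y * θ̂ y ≤ 10 ^ y) → 3 ^ x * θ̂ x ≤ 10 ^ x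
    bound x rec with x <? 271
    ... | yes x< = small x x<
    ... | no x≮ = *-cancelˡ-≤ (3 ^ (2 * M)) {{m^n≢0 3 (2 * M)}} (begin
      3 ^ (2 * M) * (3 ^ x * θ̂ x)
        ≡⟨ lem₁ (3 ^ (2 * M)) (3 ^ x) (θ̂ x) ⟩
      3 ^ x * (θ̂ x * 3 ^ (2 * M))
        ≤⟨ *-monoʳ-≤ (3 ^ x) (*-monoˡ-≤ (3 ^ (2 * M)) (≤-trans (θ̂-mono x≤6M) (θ̂[6n]≤ M z<s))) ⟩
      3 ^ x * (108 ^ M * θ̂ (2 * M) * 3 ^ (2 * M))
        ≡⟨ lem₂ (3 ^ x) (108 ^ M) (θ̂ (2 * M)) (3 ^ (2 * M)) ⟩
      3 ^ x * 108 ^ M * (3 ^ (2 * M) * θ̂ (2 * M))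
        ≤⟨ *-monoʳ-≤ (3 ^ x * 108 ^ M) (rec 2M<x) ⟩
      3 ^ x * 108 ^ M * 10 ^ (2 * M)
        ≡⟨ cong (λ u → u * 108 ^ M * 10 ^ (2 * M)) (split 3) ⟩
      3 ^ (1 + 6 * m) * 3 ^ t * 108 ^ M * 10 ^ (2 * M)
        ≡⟨ lem₃ (3 ^ (1 + 6 * m)) (3 ^ t) (108 ^ M) (10 ^ (2 * M)) ⟩
      3 ^ (1 + 6 * m) * 108 ^ M * 10 ^ (2 * M) * 3 ^ t
        ≤⟨ *-mono-≤ (subst P (m∸n+n≡m 45≤m) (large (m ∸ 45))) (^-monoˡ-≤ t (from-yes (3 ≤? 10))) ⟩
      3 ^ (2 * M) * 10 ^ (1 + 6 * m) * 10 ^ t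
        ≡⟨ *-assoc (3 ^ (2 * M)) (10 ^ (1 + 6 * m)) (10 ^ t) ⟩
      3 ^ (2 * M) * (10 ^ (1 + 6 * m) * 10 ^ t)
        ≡⟨ cong (3 ^ (2 * M) *_) (split 10) ⟨
      3 ^ (2 * M) * 10 ^ x ∎)
      where
      -- Then `1 + 6 * m ≤ x ≤ 6 * suc m`, and `x ≥ 271`, which is 6 · 45 + 1, gives the `45 ≤ m` at
      -- which `growth` starts.
      m = (x ∸ 1) / 6
      M = suc m
      P : ℕ → Set
      P m = 3 ^ (1 + 6 * m) * 108 ^ suc m * 10 ^ (2 * suc m) ≤ 3 ^ (2 * suc m) * 10 ^ (1 + 6 * m)
      t = x ∸ (1 + 6 * m)
      271≤x = ≮⇒≥ x≮
      1≤x : 1 ≤ x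
      1≤x = ≤-trans (s≤s z≤n) 271≤x
      45≤m : 45 ≤ m
      45≤m = /-monoˡ-≤ 6 (∸-monoˡ-≤ 1 271≤x)
      6m≤ : 6 * m ≤ x ∸ 1
      6m≤ = subst (_≤ x ∸ 1) (*-comm m 6) (m/n*n≤m (x ∸ 1) 6)
      1+6m≤x : 1 + 6 * m ≤ x
      1+6m≤x = subst (1 + 6 * m ≤_) (m+[n∸m]≡n 1≤x) (s≤s 6m≤)
      x≤6M : x ≤ 6 * M
      x≤6M = subst₂ _≤_ (m+[n∸m]≡n 1≤x) (*-comm M 6)
        (subst (_< M * 6) (sym (m≡m%n+[m/n]*n (x ∸ 1) 6)) (+-monoˡ-< (m * 6) (m%n<n (x ∸ 1) 6)))
      2M<x : 2 * M < x
      2M<x = ≤-trans (≤-from-+ 2 (*-monoʳ-≤ 4 (≤-trans (s≤s z≤n) 45≤m)) (lem m)) 1+6m≤x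
        where
        lem : ∀ m → (1 + 6 * m) + 4 * 1 ≡ suc (2 * suc m) + 4 * m + 2
        lem = solve-∀
      split : ∀ a → a ^ x ≡ a ^ (1 + 6 * m) * a ^ t
      split a = trans (cong (a ^_) (sym (m+[n∸m]≡n 1+6m≤x))) (^-distribˡ-+-* a (1 + 6 * m) t)
      lem₁ : ∀ a b c → a * (b * c) ≡ b * (c * a)
      lem₁ = solve-∀
      lem₂ : ∀ a b c d → a * (b * c * d) ≡ a * b * (d * c)
      lem₂ = solve-∀
      lem₃ : ∀ a b c d → a * b * c * d ≡ a * c * d * b
      lem₃ = solve-∀

  -- Primes between x and 5 x / 3

  ⟦≤⟧≤1 : ∀ m n → ⟦ m ≤ n ⟧ ≤ 1
  ⟦≤⟧≤1 m n with m ≤? n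
  ... | yes _ = ≤-refl
  ... | no  _ = z≤n

  ^-∑⟦≤⟧≤ : ∀ K N q → 1 ≤ q → 1 ≤ N → q ^ ∑ K (λ i → ⟦ q ^ i ≤ N ⟧) ≤ N
  ^-∑⟦≤⟧≤ zero    N q 1≤q 1≤N = 1≤N
  ^-∑⟦≤⟧≤ (suc K) N q 1≤q 1≤N with q ^ suc K ≤? N
  ... | no _  = subst (λ e → q ^ e ≤ N) (sym (+-identityʳ (∑ K λ i → ⟦ q ^ i ≤ N ⟧))) (^-∑⟦≤⟧≤ K N q 1≤q 1≤N)
  ... | yes q^≤N = ≤-trans
    (^-monoʳ-≤ q {{>-nonZero 1≤q}} (≤-trans (+-monoˡ-≤ 1 (∑≤ K)) (≤-reflexive (+-comm K 1)))) q^≤N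
    where
    ∑≤ : ∀ K → ∑ K (λ i → ⟦ q ^ i ≤ N ⟧) ≤ K
    ∑≤ zero    = z≤n
    ∑≤ (suc K) = ≤-trans (+-mono-≤ (∑≤ K) (⟦≤⟧≤1 (q ^ suc K) N)) (≤-reflexive (+-comm K 1))

  ∑⟦≤⟧≤1 : ∀ K N q → N < q * q → 1 ≤ q → ∑ K (λ i → ⟦ q ^ i ≤ N ⟧) ≤ 1
  ∑⟦≤⟧≤1 zero          N q _ _ = z≤n
  ∑⟦≤⟧≤1 1             N q _ _ = ⟦≤⟧≤1 (q ^ 1) N
  ∑⟦≤⟧≤1 (suc K′@(suc K)) N q N<q² 1≤q with ∑⟦≤⟧≤1 K′ N q N<q² 1≤q | q * q ^ K′ ≤? N
  ... | ih | no _ = subst (_≤ 1) (sym (+-identityʳ (∑ K′ λ i → ⟦ q ^ i ≤ N ⟧))) ih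
  ... | ih | yes q^≤N = contradiction (<-≤-trans N<q² (≤-trans q²≤ q^≤N)) (<-irrefl refl)
    where
    q²≤ : q * q ≤ q * (q * q ^ K)
    q²≤ = *-monoʳ-≤ q (m≤m*n q (q ^ K) {{>-nonZero (q^i≥1 K 1≤q)}})

  padding : ℕ → ℕ → ℕ → ℕ
  padding s N q with q ≤? s
  ... | yes _ = N
  ... | no  _ = 1

  ∏-padding≤ : ∀ s N K → 1 ≤ N → ∏ K (padding s N) ≤ N ^ s
  ∏-padding≤ s N K 1≤N = go K
    where
    instance _ = >-nonZero 1≤N
    low : ∀ K → K ≤ s → ∏ K (padding s N) ≤ N ^ K
    low zero    _   = ≤-refl
    low (suc K) K<s with suc K ≤? s
    ... | yes _ = ≤-trans (*-monoˡ-≤ N (low K (<⇒≤ K<s))) (≤-reflexive (*-comm (N ^ K) N))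
    ... | no K≮ = contradiction K<s K≮
    go : ∀ K → ∏ K (padding s N) ≤ N ^ s
    go zero = m^n>0 N s
    go (suc K) with suc K ≤? s in eq
    ... | no _  = ≤-trans (≤-reflexive (*-identityʳ _)) (go K)
    ... | yes K<s = ≤-trans
      (≤-trans (*-monoˡ-≤ N (low K (<⇒≤ K<s))) (≤-reflexive (*-comm (N ^ K) N))) (^-monoʳ-≤ N K<s)

  -- The passage from ψ to θ. Primes above `s ≥ √N` enter to the first power only, and each of the
  -- at most `s` others contributes at most `N`. Any such `s` is allowed, so that a power of 2 can
  -- be taken later.
  ∏-powersUpTo≤ : ∀ s N → 1 ≤ N → N ≤ s * s →
    ∏ N (λ q → primeOr1 q ^ powersUpTo N q) ≤ N ^ s * θ̂ N
  ∏-powersUpTo≤ s N 1≤N N≤s² = begin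
    ∏ N (λ q → primeOr1 q ^ powersUpTo N q)   ≤⟨ ∏-mono N (λ q 1≤q _ → pointwise q 1≤q) ⟩
    ∏ N (λ q → padding s N q * primeOr1 q)    ≡⟨ ∏-* N (padding s N) primeOr1 ⟩
    ∏ N (padding s N) * θ̂ N                   ≤⟨ *-monoˡ-≤ (θ̂ N) (∏-padding≤ s N N 1≤N) ⟩
    N ^ s * θ̂ N                               ∎
    where
    open ≤-Reasoning
    pointwise : ∀ q → 1 ≤ q → primeOr1 q ^ powersUpTo N q ≤ padding s N q * primeOr1 q
    pointwise q 1≤q with prime? q | q ≤? s
    ... | no _  | yes _ rewrite ^-zeroˡ (powersUpTo N q) = ≤-trans 1≤N (≤-reflexive (sym (*-identityʳ N)))
    ... | no _  | no _ rewrite ^-zeroˡ (powersUpTo N q) = ≤-refl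
    ... | yes _ | yes _ = ≤-trans (^-∑⟦≤⟧≤ N N q 1≤q 1≤N) (m≤m*n N q {{>-nonZero 1≤q}})
    ... | yes _ | no q≰s = ≤-trans
      (^-monoʳ-≤ q {{>-nonZero 1≤q}} (∑⟦≤⟧≤1 N N q (≤-<-trans N≤s² (*-mono-< s<q s<q)) 1≤q))
      (≤-reflexive (trans (*-identityʳ q) (sym (*-identityˡ q))))
      where s<q = ≰⇒> q≰s

  θ̂-lower : ∀ n s → 1 ≤ n → 6 * n ≤ s * s → 108 ^ n ≤ 2 * suc n * ((6 * n) ^ s * θ̂ (6 * n))
  θ̂-lower n s 1≤n N≤s² = *-cancelˡ-≤ D {{chebyshevDen≢0 n}} (begin
    D * 108 ^ n                       ≡⟨ *-comm D (108 ^ n) ⟩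
    108 ^ n * D                       ≤⟨ chebyshevNum≥ n 1≤n ⟩
    2 * suc n * chebyshevNum n        ≤⟨ *-monoʳ-≤ (2 * suc n) (≤-trans (chebyshev-upper n)
                                           (*-monoʳ-≤ D (∏-powersUpTo≤ s (6 * n) 1≤6n N≤s²))) ⟩
    2 * suc n * (D * R)               ≡⟨ x∙yz≈y∙xz (2 * suc n) D R ⟩
    D * (2 * suc n * R)               ∎)
    where
    open ≤-Reasoning
    D = chebyshevDen n
    R = (6 * n) ^ s * θ̂ (6 * n)
    1≤6n : 1 ≤ 6 * n
    1≤6n = ≤-trans 1≤n (m≤n*m n 6)

  primeFree⇒θ̂≡ : ∀ {x N} → x ≤ N → (∀ q → x < q → q ≤ N → ¬ Prime q) → θ̂ N ≡ θ̂ x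
  primeFree⇒θ̂≡ {x} {N} x≤N free =
    ∏-split x N x≤N (λ _ _ → refl) λ q x<q q≤N → primeOr1-¬prime (free q x<q q≤N)

  ^-distribʳ-* : ∀ a b n → (a * b) ^ n ≡ a ^ n * b ^ n
  ^-distribʳ-* a b zero    = refl
  ^-distribʳ-* a b (suc n) = trans (cong (a * b *_) (^-distribʳ-* a b n)) (*-interchange a b (a ^ n) (b ^ n))

  -- 108⁵ 3¹⁸ > 5 · 10¹⁸, so the lower bound 108ⁿ for θ̂ (6n) beats the upper bound
  -- (10/3)ˣ for θ̂ x once 5 x ≤ 18 n + 17, up to the subexponential factor W.
  primeFree⇒4^n≤ : ∀ n x s → 1 ≤ n → 6 * n ≤ s * s → x ≤ 6 * n → 18 * n ≤ 5 * x → 5 * x ≤ 18 * n + 17 →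
    (∀ q → x < q → q ≤ 6 * n → ¬ Prime q) →
    4 ^ n ≤ (2 * suc n * (6 * n) ^ s) ^ 5 * 10 ^ 17
  primeFree⇒4^n≤ n x s 1≤n N≤s² x≤N lo hi free =
    *-cancelˡ-≤ ((10 ^ 18) ^ n) {{m^n≢0 (10 ^ 18) n}} (begin
    (10 ^ 18) ^ n * 4 ^ n            ≡⟨ ^-distribʳ-* (10 ^ 18) 4 n ⟨
    -- The quotient exceeds 5; the value 4 is used because the comparison that follows is among
    -- powers of 2.
    (10 ^ 18 * 4) ^ n                ≤⟨ ^-monoˡ-≤ n (from-yes (10 ^ 18 * 4 ≤? 108 ^ 5 * 3 ^ 18)) ⟩
    (108 ^ 5 * 3 ^ 18) ^ n           ≡⟨ ^-distribʳ-* (108 ^ 5) (3 ^ 18) n ⟩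
    (108 ^ 5) ^ n * (3 ^ 18) ^ n
      ≡⟨ cong₂ _*_ (swap-exp 108 5 n) (^-*-assoc 3 18 n) ⟩
    (108 ^ n) ^ 5 * 3 ^ (18 * n)     ≤⟨ *-monoʳ-≤ ((108 ^ n) ^ 5) (^-monoʳ-≤ 3 lo) ⟩
    (108 ^ n) ^ 5 * 3 ^ (5 * x)      ≡⟨ cong ((108 ^ n) ^ 5 *_) (x*5 3) ⟩
    (108 ^ n) ^ 5 * (3 ^ x) ^ 5      ≡⟨ ^-distribʳ-* (108 ^ n) (3 ^ x) 5 ⟨
    (108 ^ n * 3 ^ x) ^ 5            ≤⟨ ^-monoˡ-≤ 5 base ⟩
    (W * 10 ^ x) ^ 5                 ≡⟨ ^-distribʳ-* W (10 ^ x) 5 ⟩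
    W ^ 5 * (10 ^ x) ^ 5             ≡⟨ cong (W ^ 5 *_) (x*5 10) ⟨
    W ^ 5 * 10 ^ (5 * x)             ≤⟨ *-monoʳ-≤ (W ^ 5) (^-monoʳ-≤ 10 hi) ⟩
    W ^ 5 * 10 ^ (18 * n + 17)
      ≡⟨ cong (W ^ 5 *_) (trans (^-distribˡ-+-* 10 (18 * n) 17) (cong (_* 10 ^ 17) (sym (^-*-assoc 10 18 n)))) ⟩
    W ^ 5 * ((10 ^ 18) ^ n * 10 ^ 17)
      ≡⟨ x∙yz≈y∙xz (W ^ 5) ((10 ^ 18) ^ n) (10 ^ 17) ⟩
    (10 ^ 18) ^ n * (W ^ 5 * 10 ^ 17) ∎)
    where
    open ≤-Reasoning
    W = 2 * suc n * (6 * n) ^ s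
    lem : ∀ a b c d → a * (b * c) * d ≡ a * b * (d * c)
    lem = solve-∀
    swap-exp : ∀ a m n → (a ^ m) ^ n ≡ (a ^ n) ^ m
    swap-exp a m n = trans (^-*-assoc a m n) (trans (cong (a ^_) (*-comm m n)) (sym (^-*-assoc a n m)))
    x*5 : ∀ a → a ^ (5 * x) ≡ (a ^ x) ^ 5
    x*5 a = trans (cong (a ^_) (*-comm 5 x)) (sym (^-*-assoc a x 5))
    base : 108 ^ n * 3 ^ x ≤ W * 10 ^ x
    base = begin
      108 ^ n * 3 ^ x                                      ≤⟨ *-monoˡ-≤ (3 ^ x) (θ̂-lower n s 1≤n N≤s²) ⟩
      2 * suc n * ((6 * n) ^ s * θ̂ (6 * n)) * 3 ^ x        ≡⟨ lem (2 * suc n) ((6 * n) ^ s) (θ̂ (6 * n)) (3 ^ x) ⟩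
      W * (3 ^ x * θ̂ (6 * n))
        ≡⟨ cong (λ z → W * (3 ^ x * z)) (primeFree⇒θ̂≡ x≤N free) ⟩
      W * (3 ^ x * θ̂ x)                                    ≤⟨ *-monoʳ-≤ W (θ̂-bound x) ⟩
      W * 10 ^ x                                           ∎

  4^10≤n⇒between-powers : ∀ N d → 4 ^ 10 ≤ N → N < 4 ^ (d + 10) → ∃ λ t → 10 ≤ t × 4 ^ t ≤ N × N < 4 ^ suc t
  4^10≤n⇒between-powers N zero    lo hi = contradiction hi (≤⇒≯ lo)
  4^10≤n⇒between-powers N (suc d) lo hi with 4 ^ (d + 10) ≤? N
  ... | yes le = d + 10 , m≤n+m 10 d , le , hi
  ... | no ≰   = 4^10≤n⇒between-powers N d lo (≰⇒> ≰)

  -- In `primeFree-bound⇒⊥` the bound for `6 * n` has leading term `60 * suc t * 2 ^ t`, and a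
  -- further `30 * suc t * 2 ^ t` covers the rest. Together they stay within `4 ^ t` from `t = 10`
  -- on.
  90*suc≤2^ : ∀ d → 90 * suc (d + 10) ≤ 2 ^ (d + 10)
  90*suc≤2^ zero    = from-yes (90 * 11 ≤? 2 ^ 10)
  90*suc≤2^ (suc d) = ≤-from-+ (90 * (d + 10)) (*-monoʳ-≤ 2 (90*suc≤2^ d)) (lem (d + 10) (2 ^ (d + 10)))
    where
    lem : ∀ e u → 2 * u + 2 * (90 * suc e) ≡ 90 * suc (suc e) + 2 * u + 90 * e
    lem = solve-∀

  4^≡2^*2^ : ∀ t → 4 ^ t ≡ 2 ^ t * 2 ^ t
  4^≡2^*2^ = ^-distribʳ-* 2 2

  -- In base 4 the exponent on the right is of order t 2 ^ t, while n is of order 4 ^ t.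
  primeFree-bound⇒⊥ : ∀ n t s → 2 ≤ n → 10 ≤ t → 4 ^ t ≤ 6 * n → 6 * n < 4 ^ suc t → s ≡ 2 ^ suc t →
    ¬ 4 ^ n ≤ (2 * suc n * (6 * n) ^ s) ^ 5 * 10 ^ 17
  primeFree-bound⇒⊥ n t s 2≤n 10≤t lo hi refl bound = <⇒≱ contra exponents
    where
    open ≤-Reasoning
    u = 2 ^ t
    e = suc s * 5
    W≤ : 2 * suc n * (6 * n) ^ s ≤ 4 ^ (suc t * suc s)
    W≤ = begin
      2 * suc n * (6 * n) ^ s   ≤⟨ *-monoˡ-≤ ((6 * n) ^ s) 2*suc≤6* ⟩
      (6 * n) ^ suc s           ≤⟨ ^-monoˡ-≤ (suc s) (<⇒≤ hi) ⟩
      (4 ^ suc t) ^ suc s       ≡⟨ ^-*-assoc 4 (suc t) (suc s) ⟩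
      4 ^ (suc t * suc s)       ∎
      where
      lem : ∀ n → 6 * n + 2 * 1 ≡ 2 * suc n + 2 * n + 2 * n
      lem = solve-∀
      2*suc≤6* : 2 * suc n ≤ 6 * n
      2*suc≤6* = ≤-from-+ (2 * n) (*-monoʳ-≤ 2 (<⇒≤ 2≤n)) (lem n)
    4^n≤ : 4 ^ n ≤ 4 ^ (suc t * suc s * 5 + 29)
    4^n≤ = begin
      4 ^ n                                      ≤⟨ bound ⟩
      (2 * suc n * (6 * n) ^ s) ^ 5 * 10 ^ 17
        ≤⟨ *-mono-≤ (^-monoˡ-≤ 5 W≤) (from-yes (10 ^ 17 ≤? 4 ^ 29)) ⟩
      (4 ^ (suc t * suc s)) ^ 5 * 4 ^ 29         ≡⟨ cong (_* 4 ^ 29) (^-*-assoc 4 (suc t * suc s) 5) ⟩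
      4 ^ (suc t * suc s * 5) * 4 ^ 29           ≡⟨ ^-distribˡ-+-* 4 (suc t * suc s * 5) 29 ⟨
      4 ^ (suc t * suc s * 5 + 29)               ∎
    exponents : n ≤ suc t * suc s * 5 + 29
    exponents = ≮⇒≥ λ lt → <⇒≱ (^-monoʳ-< 4 (s≤s (s≤s z≤n)) lt) 4^n≤
    90t≤u : 90 * suc t ≤ u
    90t≤u = subst (λ t → 90 * suc t ≤ 2 ^ t) (m∸n+n≡m 10≤t) (90*suc≤2^ (t ∸ 10))
    contra : suc t * suc s * 5 + 29 < n
    contra = *-cancelˡ-< 6 _ n (begin-strict
      6 * (suc t * suc s * 5 + 29)             ≡⟨ lem₁ t u ⟩
      60 * suc t * u + (30 * suc t + 174)      <⟨ +-monoʳ-< (60 * suc t * u) small ⟩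
      60 * suc t * u + 30 * suc t * u          ≡⟨ lem₂ t u ⟩
      90 * suc t * u                           ≤⟨ *-monoˡ-≤ u 90t≤u ⟩
      u * u                                    ≡⟨ 4^≡2^*2^ t ⟨
      4 ^ t                                    ≤⟨ lo ⟩
      6 * n                                    ∎)
      where
      lem₁ : ∀ t u → 6 * (suc t * suc (2 * u) * 5 + 29) ≡ 60 * suc t * u + (30 * suc t + 174)
      lem₁ = solve-∀
      lem₂ : ∀ t u → 60 * suc t * u + 30 * suc t * u ≡ 90 * suc t * u
      lem₂ = solve-∀
      lem₃ : ∀ t → 30 * suc t + (30 * suc t * 10) ≡ 30 * suc t * 11
      lem₃ = solve-∀
      small : 30 * suc t + 174 < 30 * suc t * u
      small = begin-strict
        30 * suc t + 174                 <⟨ +-monoʳ-< (30 * suc t) (≤-trans (from-yes (175 ≤? 30 * 11 * 10))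
                                            (*-monoˡ-≤ 10 (*-monoʳ-≤ 30 (s≤s 10≤t)))) ⟩
        30 * suc t + 30 * suc t * 10     ≡⟨ lem₃ t ⟩
        30 * suc t * 11                  ≤⟨ *-monoʳ-≤ (30 * suc t) (≤-trans
                                            (≤-trans (from-yes (11 ≤? 90)) (m≤m*n 90 (suc t))) 90t≤u) ⟩
        30 * suc t * u                   ∎

  n<4^[n+10] : ∀ N → N < 4 ^ (N + 10)
  n<4^[n+10] N = <-≤-trans (n<2^n N) (≤-trans (^-monoʳ-≤ 2 (m≤m+n N 10)) (^-monoˡ-≤ (N + 10) 2≤4))
    where
    2≤4 : 2 ≤ 4
    2≤4 = s≤s (s≤s z≤n)

  -- With n = ⌊5x/18⌋, 6n is the largest multiple of 6 up to 5x/3. If the next prime exceeds it, (x,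
  -- 6n] contains no prime and the two bounds for `θ̂` contradict each other.
  primeBetween-large : ∀ x → 630000 ≤ x → ∃ λ q → Prime q × x < q × 3 * q ≤ 5 * x
  primeBetween-large x x≥ with nextPrime x
  ... | q , prq , x<q , least with q ≤? 6 * (5 * x / 18)
  ... | yes q≤ = q , prq , x<q , ≤-trans (*-monoʳ-≤ 3 q≤) (≤-trans (≤-reflexive (lem (5 * x / 18))) (m/n*n≤m (5 * x) 18))
    where
    lem : ∀ n → 3 * (6 * n) ≡ n * 18
    lem = solve-∀
  ... | no q≰ with 4^10≤n⇒between-powers (6 * (5 * x / 18)) (6 * (5 * x / 18)) 4^10≤ (n<4^[n+10] _)
    where
    -- The threshold 630000 is chosen for this bound: 6 · (5 · 630000 / 18) = 1050000 is just above
    -- 4^10 = 1048576.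
    4^10≤ : 4 ^ 10 ≤ 6 * (5 * x / 18)
    4^10≤ = ≤-trans (from-yes (4 ^ 10 ≤? 6 * (5 * 630000 / 18))) (*-monoʳ-≤ 6 (/-monoˡ-≤ 18 (*-monoʳ-≤ 5 x≥)))
  ... | t , 10≤t , lo , hi = contradiction
    (primeFree⇒4^n≤ n x (2 ^ suc t) (<⇒≤ 2≤n) N≤s² x≤6n lower upper free)
    (primeFree-bound⇒⊥ n t (2 ^ suc t) 2≤n 10≤t lo hi refl)
    where
    n = 5 * x / 18
    2≤n : 2 ≤ n
    2≤n = ≤-trans (from-yes (2 ≤? 5 * 630000 / 18)) (/-monoˡ-≤ 18 (*-monoʳ-≤ 5 x≥))
    N≤s² : 6 * n ≤ 2 ^ suc t * 2 ^ suc t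
    N≤s² = subst (6 * n ≤_) (4^≡2^*2^ (suc t)) (<⇒≤ hi)
    lower : 18 * n ≤ 5 * x
    lower = subst (_≤ 5 * x) (*-comm n 18) (m/n*n≤m (5 * x) 18)
    upper : 5 * x ≤ 18 * n + 17
    upper = s≤s⁻¹ (subst₂ _<_ (sym (m≡m%n+[m/n]*n (5 * x) 18)) (lem n) (+-monoˡ-< (n * 18) (m%n<n (5 * x) 18)))
      where
      lem : ∀ n → 18 + n * 18 ≡ suc (18 * n + 17)
      lem = solve-∀
    x≤6n : x ≤ 6 * n
    x≤6n = *-cancelˡ-≤ 5 (≤-trans upper (≤-from-+ 7 (*-monoʳ-≤ 12 2≤n) (lem n)))
      where
      lem : ∀ n → 5 * (6 * n) + 12 * 2 ≡ 18 * n + 17 + 12 * n + 7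
      lem = solve-∀
    free : ∀ r → x < r → r ≤ 6 * n → ¬ Prime r
    free r x<r r≤ prr = q≰ (≤-trans (least prr x<r) r≤)

  -- Trial division below a given `s` with `s * s > q`: even 953977, the largest prime of `chain`,
  -- takes fewer than a thousand divisions.
  TrialPrime : ℕ × ℕ → Set
  TrialPrime (q , s) = 1 < q × q < s * s × (∀ {d} → d < s → 1 < d → ¬ d ∣ q)

  trialPrime? : ∀ qs → Dec (TrialPrime qs)
  trialPrime? (q , s) = 1 <? q ×-dec q <? s * s ×-dec
    allUpTo? (λ d → 1 <? d →-dec ¬? (d ∣? q)) s

  trialPrime⇒prime : ∀ {q s} → TrialPrime (q , s) → Prime q
  trialPrime⇒prime {q} {s} (1<q , q<s² , trial) =
    rough∧square>⇒prime rough q<s²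
    where
    instance _ = n>1⇒nonTrivial 1<q
    rough : s Rough q
    rough (hasNonTrivialDivisor {divisor = d} d<s d∣q) = trial d<s (nonTrivial⇒n>1 d) d∣q

  -- Each prime is paired with a bound for the trial divisions that establish it.
  chain : List (ℕ × ℕ)
  chain =
    (3 , 2) ∷ (5 , 3) ∷ (7 , 3) ∷ (11 , 4) ∷ (17 , 5) ∷ (23 , 5) ∷
    (37 , 7) ∷ (61 , 8) ∷ (101 , 11) ∷ (167 , 13) ∷ (277 , 17) ∷ (461 , 22) ∷
    (761 , 28) ∷ (1259 , 36) ∷ (2089 , 46) ∷ (3469 , 59) ∷ (5779 , 77) ∷ (9631 , 99) ∷
    (16033 , 127) ∷ (26717 , 164) ∷ (44519 , 211) ∷ (74197 , 273) ∷ (123661 , 352) ∷ (206083 , 454) ∷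
    (343433 , 587) ∷ (572387 , 757) ∷ (953977 , 977) ∷ []

  -- The first entry above `x` is at most 5/3 of its predecessor, which is at most `x`.
  chain-primeBetween : ∀ c ps → All TrialPrime ps →
    Linked (λ a b → 3 * proj₁ b ≤ 5 * proj₁ a) (c ∷ ps) → ∀ {x} → proj₁ c ≤ x →
    x < foldl (λ _ → proj₁) (proj₁ c) ps → ∃ λ q → Prime q × x < q × 3 * q ≤ 5 * x
  chain-primeBetween c []       _  _ c≤x x<c = contradiction x<c (≤⇒≯ c≤x)
  chain-primeBetween c (p ∷ ps) (pr ∷ prs) (3p≤5c ∷ link) {x} c≤x x<last with x <? proj₁ p
  ... | yes x<p = proj₁ p , trialPrime⇒prime pr , x<p , ≤-trans 3p≤5c (*-monoʳ-≤ 5 c≤x)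
  ... | no x≮p  = chain-primeBetween p ps prs link (≮⇒≥ x≮p) x<last

  primeBetween : ∀ x → 2 ≤ x → ∃ λ q → Prime q × x < q × 3 * q ≤ 5 * x
  primeBetween x 2≤x with 630000 ≤? x
  ... | yes large = primeBetween-large x large
  ... | no small = chain-primeBetween (2 , 2) chain
    (from-yes (All.all? trialPrime? chain))
    (from-yes (Linked.linked? (λ a b → 3 * proj₁ b ≤? 5 * proj₁ a) ((2 , 2) ∷ chain)))
    2≤x (<-trans (≰⇒> small) (from-yes (630000 <? foldl (λ _ → proj₁) 2 chain)))

  -- Sets of primes

  -- Finite sets of primes as strictly decreasing lists: the strict bound rules out repetition and
  -- makes the head the largest element.
  data PrimesBelow (b : ℕ) : List ℕ → Set where
    []   : PrimesBelow b []
    cons : ∀ {q qs} → Prime q → q < b → PrimesBelow q qs → PrimesBelow b (q ∷ qs)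

  PrimesBelow-mono : ∀ {b c qs} → b ≤ c → PrimesBelow b qs → PrimesBelow c qs
  PrimesBelow-mono b≤c []                = []
  PrimesBelow-mono b≤c (cons pr q<b dec) = cons pr (<-≤-trans q<b b≤c) dec

  product≥1 : ∀ {b qs} → PrimesBelow b qs → 1 ≤ product qs
  product≥1 []              = ≤-refl
  product≥1 (cons pr _ dec) = *-mono-≤ (prime≥1 pr) (product≥1 dec)

  2∣n⊎2∣1+n : ∀ n → 2 ∣ n ⊎ 2 ∣ suc n
  2∣n⊎2∣1+n zero = inj₁ (2 ∣0)
  2∣n⊎2∣1+n (suc n) with 2∣n⊎2∣1+n n
  ... | inj₁ 2∣n   = inj₂ (∣m∣n⇒∣m+n ∣-refl 2∣n)
  ... | inj₂ 2∣1+n = inj₁ 2∣1+n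

  -- Parity. A gap of at least 2 is what allows a prime to give way to a smaller odd prime together
  -- with 2 without raising the sum.
  odd-prime-gap : ∀ {q r} → Prime q → Prime r → 3 ≤ q → q < r → 2 + q ≤ r
  odd-prime-gap {q} {r} prq prr 3≤q q<r with 2∣n⊎2∣1+n q
  ... | inj₁ 2∣q   = contradiction (prime∣prime⇒≡ prime[2] prq 2∣q) (<⇒≢ 3≤q)
  ... | inj₂ 2∣1+q = ≤∧≢⇒< q<r λ { refl →
    <⇒≢ (m<n⇒m<1+n 3≤q) (prime∣prime⇒≡ prime[2] prr 2∣1+q) }

  prime≥-next : ∀ {q} m → ¬ Prime m → Prime q → m ≤ q → suc m ≤ q
  prime≥-next m ¬prm prq m≤q = ≤∧≢⇒< m≤q λ { refl → ¬prm prq }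

  -- In the exchange argument the head q of the list is traded for the last initial prime,
  -- which raises the deficit D by their difference.
  raise-excess : ∀ {q s D S P} → q + s + D ≤ S + P → P ≤ q → s + (D + (q ∸ P)) ≤ S
  raise-excess {q} {s} {D} {S} {P} le P≤q = lem (q ∸ P) (sym (m+[n∸m]≡n P≤q))
    where
    lem : ∀ e → q ≡ P + e → s + (D + e) ≤ S
    lem e refl = +-cancelʳ-≤ P _ S (subst (_≤ S + P) (assoc P e s D) le)
      where
      assoc : ∀ P e s D → P + e + s + D ≡ s + (D + e) + P
      assoc = solve-∀

  largestPrime≤ : ∀ y → 2 ≤ y → ∃ λ R → Prime R × R ≤ y × (∀ {r} → Prime r → r ≤ y → r ≤ R)
  largestPrime≤ (suc y) 2≤1+y with prime? (suc y)
  ... | yes pr = suc y , pr , ≤-refl , λ _ r≤ → r≤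
  ... | no ¬pr with m≤n⇒m<n∨m≡n 2≤1+y
  ...   | inj₂ refl      = contradiction prime[2] ¬pr
  ...   | inj₁ (s≤s 2≤y) with largestPrime≤ y 2≤y
  ...     | R , prR , R≤y , greatest = R , prR , m≤n⇒m≤1+n R≤y ,
    λ prr r≤ → greatest prr (s≤s⁻¹ (≤∧≢⇒< r≤ λ { refl → ¬pr prr }))

  largestPrime≤-close : ∀ y → 2 ≤ y →
    ∃ λ R → Prime R × R ≤ y × (∀ {r} → Prime r → r ≤ y → r ≤ R) × 3 * suc y ≤ 5 * R
  largestPrime≤-close y 2≤y with largestPrime≤ y 2≤y
  ... | R , prR , R≤y , greatest with primeBetween R (prime≥2 prR)
  ...   | q , prq , R<q , 3q≤5R = R , prR , R≤y , greatest ,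
    ≤-trans (*-monoʳ-≤ 3 (≰⇒> λ q≤y → <⇒≱ R<q (greatest prq q≤y))) 3q≤5R

  -- The bound `b` is recorded because elements discarded from the top are put back in front of `T`.
  StrictExtension : ℕ → ℕ → List ℕ → Set
  StrictExtension b n S = ∃ λ T →
    PrimesBelow b T × length T ≡ suc (length S) × sum T ≤ n × 6 * product S < 5 * product T

  -- For q = y + 1, closeness gives 6 q / (5 R) ≤ 2, and 15/7 > 2. Here and in the next two lemmas
  -- `s` is the product of the set without q, and `M` the primorial that replaces it.
  exchange-excess1 : ∀ y R s M → 3 * suc y ≤ 5 * R → 5 ≤ R → 1 ≤ M → 15 * s ≤ 7 * M →
    6 * ((y + 1) * s) < 5 * (R * M)
  exchange-excess1 y R s M y≤ 5≤R 1≤M s≤ = *-cancelˡ-< 15 _ _ (begin-strict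
    15 * (6 * ((y + 1) * s))   ≡⟨ lem₁ y s ⟩
    30 * s * (3 * suc y)       ≤⟨ *-monoʳ-≤ (30 * s) y≤ ⟩
    30 * s * (5 * R)           ≡⟨ lem₂ s R ⟩
    10 * R * (15 * s)          ≤⟨ *-monoʳ-≤ (10 * R) s≤ ⟩
    10 * R * (7 * M)           <⟨ m<m+n _ (*-mono-≤ {1} {5} {1} (s≤s z≤n) (*-mono-≤ (≤-trans (s≤s z≤n) 5≤R) 1≤M)) ⟩
    10 * R * (7 * M) + 5 * (R * M) ≡⟨ lem₃ R M ⟩
    15 * (5 * (R * M))         ∎)
    where
    open ≤-Reasoning
    lem₁ : ∀ y s → 15 * (6 * ((y + 1) * s)) ≡ 30 * s * (3 * suc y)
    lem₁ = solve-∀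
    lem₂ : ∀ s R → 30 * s * (5 * R) ≡ 10 * R * (15 * s)
    lem₂ = solve-∀
    lem₃ : ∀ R M → 10 * R * (7 * M) + 5 * (R * M) ≡ 15 * (5 * (R * M))
    lem₃ = solve-∀

  -- For q = y + 2, closeness gives 6 q / (5 R) ≤ 2 + 6 / (5 R) ≤ 2 + 6/25, which is below 5/2.
  exchange-excess2 : ∀ y R s M → 3 * suc y ≤ 5 * R → 5 ≤ R → 1 ≤ M → 5 * s ≤ 2 * M →
    6 * ((y + 2) * s) < 5 * (R * M)
  exchange-excess2 y R s M y≤ 5≤R 1≤M s≤ = *-cancelˡ-< 15 _ _ (begin-strict
    15 * (6 * ((y + 2) * s))         ≡⟨ lem₁ y s ⟩
    30 * s * (3 * suc y + 3)         ≤⟨ *-monoʳ-≤ (30 * s) (+-monoˡ-≤ 3 y≤) ⟩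
    30 * s * (5 * R + 3)             ≡⟨ lem₂ s R ⟩
    6 * (5 * R + 3) * (5 * s)        ≤⟨ *-monoʳ-≤ (6 * (5 * R + 3)) s≤ ⟩
    6 * (5 * R + 3) * (2 * M)        ≡⟨ lem₃ R M ⟩
    60 * (R * M) + 36 * M            <⟨ +-monoʳ-< (60 * (R * M)) (*-monoˡ-< M {{>-nonZero 1≤M}} (from-yes (36 <? 75))) ⟩
    60 * (R * M) + 15 * 5 * M        ≤⟨ +-monoʳ-≤ (60 * (R * M)) (*-monoˡ-≤ M (*-monoʳ-≤ 15 5≤R)) ⟩
    60 * (R * M) + 15 * R * M        ≡⟨ lem₄ R M ⟩
    15 * (5 * (R * M))               ∎)
    where
    open ≤-Reasoning
    lem₁ : ∀ y s → 15 * (6 * ((y + 2) * s)) ≡ 30 * s * (3 * suc y + 3)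
    lem₁ = solve-∀
    lem₂ : ∀ s R → 30 * s * (5 * R + 3) ≡ 6 * (5 * R + 3) * (5 * s)
    lem₂ = solve-∀
    lem₃ : ∀ R M → 6 * (5 * R + 3) * (2 * M) ≡ 60 * (R * M) + 36 * M
    lem₃ = solve-∀
    lem₄ : ∀ R M → 60 * (R * M) + 15 * R * M ≡ 15 * (5 * (R * M))
    lem₄ = solve-∀

  -- For q = y + D with D ≥ 3, closeness gives 6 q / (5 R) ≤ 2 + 6 (D - 1) / 25 < D.
  exchange-excess≥3 : ∀ d y R s M → 3 * suc y ≤ 5 * R → 5 ≤ R → 1 ≤ M → (3 + d) * s ≤ M →
    6 * ((y + (3 + d)) * s) < 5 * (R * M)
  exchange-excess≥3 d y R s M y≤ 5≤R 1≤M s≤ = *-cancelˡ-< (3 + d) _ _ (begin-strict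
    (3 + d) * (6 * ((y + (3 + d)) * s))       ≡⟨ lem₁ d y s ⟩
    6 * (y + (3 + d)) * ((3 + d) * s)         ≤⟨ *-monoʳ-≤ (6 * (y + (3 + d))) s≤ ⟩
    6 * (y + (3 + d)) * M                     <⟨ *-monoˡ-< M {{>-nonZero 1≤M}} coefficient ⟩
    5 * R * (3 + d) * M                       ≡⟨ lem₂ d R M ⟩
    (3 + d) * (5 * (R * M))                   ∎)
    where
    open ≤-Reasoning
    lem₁ : ∀ d y s → (3 + d) * (6 * ((y + (3 + d)) * s)) ≡ 6 * (y + (3 + d)) * ((3 + d) * s)
    lem₁ = solve-∀
    lem₂ : ∀ d R M → 5 * R * (3 + d) * M ≡ (3 + d) * (5 * (R * M))
    lem₂ = solve-∀
    lem₃ : ∀ d y → 6 * (y + (3 + d)) ≡ 2 * (3 * suc y) + (12 + 6 * d)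
    lem₃ = solve-∀
    lem₄ : ∀ d R → 2 * (5 * R) + 5 * R * (1 + d) ≡ 5 * R * (3 + d)
    lem₄ = solve-∀
    lem₅ : ∀ d → suc (12 + 6 * d) + (12 + 19 * d) ≡ 25 * (1 + d)
    lem₅ = solve-∀
    coefficient : 6 * (y + (3 + d)) < 5 * R * (3 + d)
    coefficient = begin-strict
      6 * (y + (3 + d))                ≡⟨ lem₃ d y ⟩
      2 * (3 * suc y) + (12 + 6 * d)   <⟨ +-mono-≤-< (*-monoʳ-≤ 2 y≤)
                                          (subst (12 + 6 * d <_) (lem₅ d) (m≤m+n _ (12 + 19 * d))) ⟩
      2 * (5 * R) + 25 * (1 + d)       ≤⟨ +-monoʳ-≤ (2 * (5 * R)) (*-monoˡ-≤ (1 + d) (*-monoʳ-≤ 5 5≤R)) ⟩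
      2 * (5 * R) + 5 * R * (1 + d)    ≡⟨ lem₄ d R ⟩
      5 * R * (3 + d)                  ∎

  ∉-tail : ∀ {x y : ℕ} {ys} → ¬ x ∈ y ∷ ys → ¬ x ∈ ys
  ∉-tail x∉ x∈ = x∉ (there x∈)

  snoc-2 : ∀ {b qs} → PrimesBelow b qs → ¬ 2 ∈ qs → 2 < b → PrimesBelow b (qs ++ [ 2 ])
  snoc-2 []                  2∉ 2<b = cons prime[2] 2<b []
  snoc-2 (cons pr q<b dec) 2∉ 2<b =
    cons pr q<b (snoc-2 dec (∉-tail 2∉) (≤∧≢⇒< (prime≥2 pr) λ 2≡q → 2∉ (here 2≡q)))

  length-snoc-2 : ∀ qs → length (qs ++ [ 2 ]) ≡ suc (length qs)
  length-snoc-2 qs = trans (length-++ qs) (+-comm (length qs) 1)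

  -- Equality would force 5 to divide `q`. For primes it occurs only at 5 and 3, where trading 5 for
  -- 3 and 2 gains exactly 6/5.
  prime-3q≢5r : ∀ {q r} → Prime q → q ≢ 5 → 3 * q ≢ 5 * r
  prime-3q≢5r {q} {r} prq q≢5 eq with euclidsLemma 3 q prime[5] (divides r (trans eq (*-comm 5 r)))
    where
    prime[5] : Prime 5
    prime[5] = from-yes (prime? 5)
  ... | inj₁ 5∣3 = contradiction (∣⇒≤ 5∣3) λ { (s≤s (s≤s (s≤s ()))) }
  ... | inj₂ 5∣q = q≢5 (sym (prime∣prime⇒≡ (from-yes (prime? 5)) prq 5∣q))

  -- The head q is replaced by the preceding prime r together with 2; the product then grows
  -- by the factor 2 r / q ≥ 6/5.
  exchange-for-2 : ∀ {b q r qs} → Prime q → q < b → Prime r → 2 < r → r < q → 3 * q ≤ 5 * r → q ≢ 5 →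
    PrimesBelow r qs → ¬ 2 ∈ qs → StrictExtension b (sum (q ∷ qs)) (q ∷ qs)
  exchange-for-2 {b} {q} {r} {qs} prq q<b prr 2<r r<q 3q≤5r q≢5 dec 2∉ =
    r ∷ qs ++ [ 2 ]
    , cons prr (<-trans r<q q<b) (snoc-2 dec 2∉ 2<r)
    , cong suc (length-snoc-2 qs)
    , sum≤
    , product<
    where
    open ≤-Reasoning
    sum≤ : r + sum (qs ++ [ 2 ]) ≤ q + sum qs
    sum≤ = begin
      r + sum (qs ++ [ 2 ])   ≡⟨ cong (r +_) (sum-++ qs [ 2 ]) ⟩
      r + (sum qs + 2)        ≡⟨ lem r (sum qs) ⟩
      2 + r + sum qs          ≤⟨ +-monoˡ-≤ (sum qs) (odd-prime-gap prr prq 2<r r<q) ⟩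
      q + sum qs              ∎
      where
      lem : ∀ a b → a + (b + 2) ≡ 2 + a + b
      lem = solve-∀
    product< : 6 * (q * product qs) < 5 * (r * product (qs ++ [ 2 ]))
    product< = begin-strict
      6 * (q * product qs)              ≡⟨ lem₁ q (product qs) ⟩
      3 * q * (2 * product qs)
        <⟨ *-monoˡ-< (2 * product qs) {{>-nonZero (*-mono-≤ {1} {2} {1} (s≤s z≤n) (product≥1 dec))}}
             (≤∧≢⇒< 3q≤5r (prime-3q≢5r {r = r} prq q≢5)) ⟩
      5 * r * (2 * product qs)          ≡⟨ lem₂ r (product qs) ⟩
      5 * (r * (product qs * 2))        ≡⟨ cong (λ z → 5 * (r * z)) (product-++ qs [ 2 ]) ⟨
      5 * (r * product (qs ++ [ 2 ]))   ∎
      where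
      lem₁ : ∀ q s → 6 * (q * s) ≡ 3 * q * (2 * s)
      lem₁ = solve-∀
      lem₂ : ∀ r s → 5 * r * (2 * s) ≡ 5 * (r * (s * 2))
      lem₂ = solve-∀

  -- Admissible numbers as sets of primes

  PrimesBelow⇒All : ∀ {b qs} → PrimesBelow b qs → All Prime qs
  PrimesBelow⇒All []              = []
  PrimesBelow⇒All (cons pr _ dec) = pr ∷ PrimesBelow⇒All dec

  ∈⇒< : ∀ {b q qs} → PrimesBelow b qs → q ∈ qs → q < b
  ∈⇒< (cons _ q<b _)   (here refl) = q<b
  ∈⇒< (cons _ r<b dec) (there q∈)  = <-trans (∈⇒< dec q∈) r<b

  prime²∤product : ∀ {b q qs} → Prime q → PrimesBelow b qs → ¬ q ^ 2 ∣ product qs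
  prime²∤product {q = q} prq [] q²∣1 =
    <⇒≢ (prime≥2 prq) (sym (∣1⇒≡1 (∣-trans (m∣m*n (q ^ 1)) q²∣1)))
  prime²∤product {q = q} {r ∷ qs} prq (cons prr _ dec) q²∣ with q ≟ r
  ... | no q≢r   = prime²∤product prq dec
    (prime-power-∣-cancel prq (λ q∣r → q≢r (prime∣prime⇒≡ prq prr q∣r)) 2 (product qs) q²∣)
  ... | yes refl = <-irrefl refl (∈⇒< dec (factorisationHasAllPrimeFactors prq q∣ (PrimesBelow⇒All dec)))
    where
    q∣ : q ∣ product qs
    q∣ = subst (_∣ product qs) (*-identityʳ q) (*-cancelˡ-∣ q {{prime⇒nonZero prq}} q²∣)

  product-squarefree : ∀ {b qs} → PrimesBelow b qs → Squarefree (product qs)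
  product-squarefree dec {zero} 0∣ = contradiction (0∣⇒≡0 0∣) (m<n⇒n≢0 (product≥1 dec))
  product-squarefree {qs = qs} dec {d@(suc _)} d²∣ with factorise d
  ... | record { factors = [] ; isFactorisation = eq } = eq
  ... | record { factors = q ∷ rs ; isFactorisation = eq ; factorsPrime = prq ∷ _ } =
    contradiction (∣-trans (subst (_∣ d * d) (cong (q *_) (sym (*-identityʳ q))) (*-pres-∣ q∣d q∣d)) d²∣)
      (prime²∤product prq dec)
    where
    q∣d : q ∣ d
    q∣d = divides (product rs) (trans eq (*-comm q (product rs)))

  primeFactors-product : ∀ {qs} → All Prime qs → primeFactors (product qs) ↭ qs
  primeFactors-product {qs} prs = go (product qs) refl {{productOfPrimes≢0 prs}}
    where
    go : ∀ m → m ≡ product qs → .{{NonZero m}} → primeFactors m ↭ qs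
    go (suc m) eq = factorisationUnique (factorise (suc m))
      record { factors = qs ; isFactorisation = eq ; factorsPrime = prs }

  product-admissible : ∀ {b n qs} → PrimesBelow b qs → sum qs ≤ n → Admissible (length qs) n (product qs)
  product-admissible {n = n} dec sum≤n =
      product-squarefree dec
    , ↭-length perm
    , subst (_≤ n) (sym (sum-↭ perm)) sum≤n
    where perm = primeFactors-product (PrimesBelow⇒All dec)

  insert : ∀ {b q} qs → Prime q → q < b → PrimesBelow b qs → ¬ q ∈ qs →
    ∃ λ rs → PrimesBelow b rs × rs ↭ q ∷ qs
  insert {q = q} [] prq q<b [] _ = q ∷ [] , cons prq q<b [] , ↭-refl
  insert {q = q} (r ∷ qs) prq q<b dec@(cons prr r<b dec′) q∉ with <-cmp q r
  ... | tri≈ _ refl _ = contradiction (here refl) q∉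
  ... | tri> _ _ r<q  = q ∷ r ∷ qs , cons prq q<b (cons prr r<q dec′) , ↭-refl
  ... | tri< q<r _ _ with insert qs prq q<r dec′ (∉-tail q∉)
  ...   | rs , dec-rs , perm = r ∷ rs , cons prr r<b dec-rs , ↭-trans (prep r perm) (swap r q ↭-refl)

  sortPrimes : ∀ qs → All Prime qs → Squarefree (product qs) →
    ∃ λ b → ∃ λ rs → PrimesBelow b rs × rs ↭ qs
  sortPrimes [] [] _ = 0 , [] , [] , ↭-refl
  sortPrimes (q ∷ qs) (prq ∷ prs) sf
    with sortPrimes qs prs (λ {d} d²∣ → sf {d} (∣n⇒∣m*n q d²∣))
  ... | b , rs , dec , perm with insert rs prq (m≤m⊔n (suc q) b) (PrimesBelow-mono (m≤n⊔m (suc q) b) dec) q∉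
    where
    q∉ : ¬ q ∈ rs
    q∉ q∈ = <⇒≢ (prime≥2 prq) (sym (sf {q} (*-monoʳ-∣ q (∈⇒∣product (∈-resp-↭ perm q∈)))))
  ...   | ts , dec-ts , perm′ = suc q ⊔ b , ts , dec-ts , ↭-trans perm′ (prep q perm)

  admissible⇒primes : ∀ {j n M} → Admissible j n M →
    ∃ λ b → ∃ λ qs → PrimesBelow b qs × length qs ≡ j × sum qs ≤ n × product qs ≡ M
  admissible⇒primes {M = zero} (sf , _) = contradiction (sf {2} (4 ∣0)) λ ()
  admissible⇒primes {j} {n} {M@(suc _)} (sf , ω≡j , ℓ≤n)
    with sortPrimes (factors (factorise M)) (factorsPrime (factorise M))
           (λ {d} d²∣ → sf {d} (subst (d * d ∣_) (sym (isFactorisation (factorise M))) d²∣))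
  ... | b , qs , dec , perm = b , qs , dec , trans (↭-length perm) ω≡j
    , subst (_≤ n) (sym (sum-↭ perm)) ℓ≤n
    , trans (product-↭ perm) (sym (isFactorisation (factorise M)))

  -- The exchange argument

  -- π stands for p, whose definition by a search plays no role here.
  module Enumeration
    (π : ℕ → ℕ)
    (π₁≡2 : π 1 ≡ 2) (π₂≡3 : π 2 ≡ 3) (π₃≡5 : π 3 ≡ 5)
    (π-prime : ∀ i → Prime (π (suc i)))
    (π-< : ∀ i → π i < π (suc i))
    (π-least : ∀ i {r} → Prime r → π i < r → π (suc i) ≤ r)
    where

    Σπ : ℕ → ℕ
    Σπ zero    = 0
    Σπ (suc j) = Σπ j + π (suc j)

    π-mono-≤ : ∀ {i j} → i ≤ j → π i ≤ π j
    π-mono-≤ {i} {zero}  z≤n = ≤-refl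
    π-mono-≤ {i} {suc j} i≤j with m≤n⇒m<n∨m≡n i≤j
    ... | inj₂ refl = ≤-refl
    ... | inj₁ i<j  = ≤-trans (π-mono-≤ (s≤s⁻¹ i<j)) (<⇒≤ (π-< j))

    π-greatest : ∀ i {r} → Prime r → r < π (suc i) → r ≤ π i
    π-greatest i prr r< = ≮⇒≥ λ p<r → <⇒≱ r< (π-least i prr p<r)

    Σπ-mono-≤ : ∀ {i j} → i ≤ j → Σπ i ≤ Σπ j
    Σπ-mono-≤ {i} {zero}  z≤n = ≤-refl
    Σπ-mono-≤ {i} {suc j} i≤j with m≤n⇒m<n∨m≡n i≤j
    ... | inj₂ refl = ≤-refl
    ... | inj₁ i<j  = ≤-trans (Σπ-mono-≤ (s≤s⁻¹ i<j)) (m≤m+n (Σπ j) (π (suc j)))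

    initial : ℕ → List ℕ
    initial zero    = []
    initial (suc m) = π (suc m) ∷ initial m

    length-initial : ∀ m → length (initial m) ≡ m
    length-initial zero    = refl
    length-initial (suc m) = cong suc (length-initial m)

    sum-initial : ∀ m → sum (initial m) ≡ Σπ m
    sum-initial zero    = refl
    sum-initial (suc m) = trans (cong (π (suc m) +_) (sum-initial m)) (+-comm (π (suc m)) (Σπ m))

    initial-below : ∀ m → PrimesBelow (suc (π m)) (initial m)
    initial-below zero    = []
    initial-below (suc m) = cons (π-prime m) ≤-refl (PrimesBelow-mono (π-< m) (initial-below m))

    primorial : ℕ → ℕ
    primorial m = product (initial m)

    primorial≥1 : ∀ m → 1 ≤ primorial m
    primorial≥1 zero    = ≤-refl
    primorial≥1 (suc m) = *-mono-≤ (prime≥1 (π-prime m)) (primorial≥1 m)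

    π≤head : ∀ {b q qs} → PrimesBelow b (q ∷ qs) → π (suc (length qs)) ≤ q
    π≤head {q = q} (cons pr _ []) = subst (_≤ q) (sym π₁≡2) (prime≥2 pr)
    π≤head {qs = _ ∷ qs} (cons pr _ dec@(cons _ r<q _)) =
      π-least (suc (length qs)) pr (≤-<-trans (π≤head dec) r<q)

    σ≤sum : ∀ {b qs} → PrimesBelow b qs → Σπ (length qs) ≤ sum qs
    σ≤sum [] = z≤n
    σ≤sum {qs = q ∷ qs} dec@(cons _ _ dec′) =
      ≤-trans (+-mono-≤ (σ≤sum dec′) (π≤head dec)) (≤-reflexive (+-comm (sum qs) q))

    below-π⇒initial : ∀ {b qs} → PrimesBelow b qs → b ≤ π (suc (length qs)) → qs ≡ initial (length qs)
    below-π⇒initial [] _ = refl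
    below-π⇒initial {qs = q ∷ qs} dec@(cons pr q<b dec′) b≤ =
      cong₂ _∷_ (≤-antisym q≤ (π≤head dec)) (below-π⇒initial dec′ q≤)
      where q≤ = π-greatest (suc (length qs)) pr (<-≤-trans q<b b≤)

    excess≤π : ∀ {b qs D} → PrimesBelow b qs → sum qs + D ≤ Σπ (suc (length qs)) → D ≤ π (suc (length qs))
    excess≤π {qs = qs} {D} dec le =
      +-cancelˡ-≤ (Σπ (length qs)) D _ (≤-trans (+-monoˡ-≤ D (σ≤sum dec)) le)

    initial-of-small-head : ∀ {b q qs} → PrimesBelow b (q ∷ qs) → q < π (suc (suc (length qs))) →
      q ∷ qs ≡ initial (suc (length qs))
    initial-of-small-head (cons pr _ dec) q< = below-π⇒initial (cons pr q< dec) ≤-refl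

    -- `D` acts as an extra factor: `qs` together with `D` has as many terms as the initial primes
    -- on the right, and no larger sum. If the head is `P + e`, moving `e` from it to `D` keeps the
    -- sum and does not lower the product, because `D ≤ P`; the new head `P` then cancels.
    excess*product≤primorial : ∀ {b qs} D → PrimesBelow b qs → sum qs + D ≤ Σπ (suc (length qs)) →
      D * product qs ≤ primorial (suc (length qs))
    excess*product≤primorial D [] le = *-monoˡ-≤ 1 le
    excess*product≤primorial {b} {q ∷ qs} D dec@(cons pr q<b dec′) le with q <? π (2 + length qs)
    ... | yes q<p = subst (λ xs → D * product xs ≤ primorial (2 + length qs))
      (sym (initial-of-small-head dec q<p)) (*-monoˡ-≤ (primorial (suc (length qs))) (excess≤π dec le))
    ... | no q≮p = begin
      D * (q * s)               ≡⟨ cong (λ q → D * (q * s)) (sym (m+[n∸m]≡n P≤q)) ⟩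
      D * ((P + e) * s)         ≤⟨ arith D P e s (≤-trans (m≤m+n D e) (≤-trans D′≤ (<⇒≤ (π-< m)))) ⟩
      P * ((D + e) * s)         ≤⟨ *-monoʳ-≤ P (excess*product≤primorial (D + e) dec′ le′) ⟩
      P * primorial m           ∎
      where
      open ≤-Reasoning
      m = suc (length qs)
      P = π (suc m)
      P≤q = ≮⇒≥ q≮p
      e = q ∸ P
      s = product qs
      le′ = raise-excess {q} {sum qs} {D} le P≤q
      D′≤ = excess≤π dec′ le′
      arith : ∀ D P e s → D ≤ P → D * ((P + e) * s) ≤ P * ((D + e) * s)
      arith D P e s D≤P = ≤-from-+ 0 (*-monoˡ-≤ (e * s) D≤P) (lem D P e s)
        where
        lem : ∀ D P e s → P * ((D + e) * s) + D * (e * s) ≡ D * ((P + e) * s) + P * (e * s) + 0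
        lem = solve-∀

    -- The first exchange with a larger prime is estimated exactly (hypothesis step), the
    -- remaining ones by excess*product≤primorial.
    refined-product≤primorial : ∀ D X Y →
      (∀ {P} → Prime P → 3 ≤ P → D ≤ P → X ≤ Y * P) →
      (∀ {P′ P e} → Prime P′ → Prime P → Prime (P + e) → 1 ≤ e → P′ < P → D + e ≤ P′ →
        X * (P + e) ≤ Y * ((D + e) * P)) →
      ∀ {b qs} → PrimesBelow b qs → sum qs + D ≤ Σπ (suc (length qs)) → 2 ∈ qs ⊎ 3 ≤ D →
      X * product qs ≤ Y * primorial (suc (length qs))
    -- The side condition excludes the empty list, at which the claim would read `X ≤ Y * 2`; this
    -- is false for each of the three pairs 15, 7 and 5, 2 and 5, 1 used below.
    refined-product≤primorial D X Y base step {qs = []} [] le (inj₁ ())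
    refined-product≤primorial D X Y base step {qs = []} [] le (inj₂ 3≤D) =
      contradiction (subst (3 ≤_) π₁≡2 (≤-trans 3≤D le)) λ { (s≤s (s≤s ())) }
    refined-product≤primorial D X Y base step {b} {q ∷ qs} dec@(cons pr q<b dec′) le side
      with <-cmp q (π (2 + length qs))
    ... | tri< q<p _ _ = subst (λ xs → X * product xs ≤ Y * primorial (2 + length qs))
      (sym (initial-of-small-head dec q<p))
      (≤-trans (*-monoˡ-≤ M (base (π-prime m) (≤-trans (s≤s (prime≥2 pr)) q<p) (excess≤π dec le)))
        (≤-reflexive (*-assoc Y (π (suc m)) M)))
      where
      m = suc (length qs)
      M = primorial m
    ... | tri≈ _ refl _ = subst₂ _≤_ (x∙yz≈y∙xz P X (product qs)) (x∙yz≈y∙xz P Y (primorial m))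
      (*-monoʳ-≤ P (refined-product≤primorial D X Y base step dec′
        (subst (λ D → sum qs + D ≤ Σπ m) (trans (cong (D +_) (n∸n≡0 P)) (+-identityʳ D))
          (raise-excess {P} {sum qs} {D} le ≤-refl)) (side′ side)))
      where
      m = suc (length qs)
      P = π (suc m)
      side′ : 2 ∈ P ∷ qs ⊎ 3 ≤ D → 2 ∈ qs ⊎ 3 ≤ D
      side′ (inj₂ 3≤D)          = inj₂ 3≤D
      side′ (inj₁ (there 2∈))   = inj₁ 2∈
      side′ (inj₁ (here 2≡P))   = contradiction 2≡P (<⇒≢ (subst (_≤ P) π₂≡3 (π-mono-≤ {2} (s≤s (s≤s z≤n)))))
    ... | tri> _ _ p<q = begin
      X * (q * s)              ≡⟨ cong (λ q → X * (q * s)) (sym q≡) ⟩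
      X * ((P + e) * s)        ≡⟨ *-assoc X (P + e) s ⟨
      X * (P + e) * s
        ≤⟨ *-monoˡ-≤ s (step (π-prime (length qs)) (π-prime m) (subst Prime (sym q≡) pr)
             (m<n⇒0<n∸m p<q) (π-< m) (excess≤π dec′ le′)) ⟩
      Y * ((D + e) * P) * s    ≡⟨ lem Y (D + e) P s ⟩
      Y * (P * ((D + e) * s))  ≤⟨ *-monoʳ-≤ Y (*-monoʳ-≤ P (excess*product≤primorial (D + e) dec′ le′)) ⟩
      Y * (P * primorial m)    ∎
      where
      open ≤-Reasoning
      m = suc (length qs)
      P = π (suc m)
      e = q ∸ P
      s = product qs
      q≡ : P + e ≡ q
      q≡ = m+[n∸m]≡n (<⇒≤ p<q)
      le′ = raise-excess {q} {sum qs} {D} le (<⇒≤ p<q)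
      lem : ∀ a b c d → a * (b * c) * d ≡ a * (c * (b * d))
      lem = solve-∀

    -- The infimum 15/7 is attained at the deficit-one list 7, 2 against 5, 3, 2.
    product≤primorial-excess1 : ∀ {b qs} → PrimesBelow b qs → sum qs + 1 ≤ Σπ (suc (length qs)) →
      2 ∈ qs → 15 * product qs ≤ 7 * primorial (suc (length qs))
    product≤primorial-excess1 dec le 2∈ = refined-product≤primorial 1 15 7 base step dec le (inj₁ 2∈)
      where
      base : ∀ {P} → Prime P → 3 ≤ P → 1 ≤ P → 15 ≤ 7 * P
      base _ 3≤P _ = ≤-trans (from-yes (15 ≤? 21)) (*-monoʳ-≤ 7 3≤P)
      arith : ∀ e P → 15 * ((5 + P) + (2 + e)) ≤ 7 * ((3 + e) * (5 + P))
      arith e P = subst (15 * ((5 + P) + (2 + e)) ≤_) (lem e P) (m≤m+n _ (20 * e + 6 * P + 7 * (e * P)))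
        where
        lem : ∀ e P → 15 * ((5 + P) + (2 + e)) + (20 * e + 6 * P + 7 * (e * P)) ≡ 7 * ((3 + e) * (5 + P))
        lem = solve-∀
      step : ∀ {P′ P e} → Prime P′ → Prime P → Prime (P + e) → 1 ≤ e → P′ < P → 1 + e ≤ P′ →
        15 * (P + e) ≤ 7 * ((1 + e) * P)
      step {P′} {P} {e} prP′ prP prQ 1≤e P′<P 1+e≤P′ =
        subst₂ (λ P e → 15 * (P + e) ≤ 7 * ((1 + e) * P)) (m+[n∸m]≡n 5≤P) (m+[n∸m]≡n 2≤e)
          (arith (e ∸ 2) (P ∸ 5))
        where
        3≤P : 3 ≤ P
        3≤P = ≤-trans (s≤s (prime≥2 prP′)) P′<P
        2≤e : 2 ≤ e
        2≤e = +-cancelˡ-≤ P 2 e (subst (_≤ P + e) (+-comm 2 P)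
          (odd-prime-gap prP prQ 3≤P (m<m+n P 1≤e)))
        5≤P : 5 ≤ P
        5≤P = prime≥-next 4 (from-no (prime? 4)) prP (≤-trans (s≤s (≤-trans (s≤s 2≤e) 1+e≤P′)) P′<P)

    -- The exchange with deficit 2 asks for a factor above 2 + 6/25, while
    -- `excess*product≤primorial` yields only 2.
    product≤primorial-excess2 : ∀ {b qs} → PrimesBelow b qs → sum qs + 2 ≤ Σπ (suc (length qs)) →
      2 ∈ qs → 5 * product qs ≤ 2 * primorial (suc (length qs))
    product≤primorial-excess2 dec le 2∈ = refined-product≤primorial 2 5 2 base step dec le (inj₁ 2∈)
      where
      base : ∀ {P} → Prime P → 3 ≤ P → 2 ≤ P → 5 ≤ 2 * P
      base _ 3≤P _ = ≤-trans (from-yes (5 ≤? 6)) (*-monoʳ-≤ 2 3≤P)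
      arith : ∀ e P → 5 * ((5 + P) + (1 + e)) ≤ 2 * ((3 + e) * (5 + P))
      arith e P = subst (5 * ((5 + P) + (1 + e)) ≤_) (lem e P) (m≤m+n _ (5 * e + P + 2 * (e * P)))
        where
        lem : ∀ e P → 5 * ((5 + P) + (1 + e)) + (5 * e + P + 2 * (e * P)) ≡ 2 * ((3 + e) * (5 + P))
        lem = solve-∀
      step : ∀ {P′ P e} → Prime P′ → Prime P → Prime (P + e) → 1 ≤ e → P′ < P → 2 + e ≤ P′ →
        5 * (P + e) ≤ 2 * ((2 + e) * P)
      step {P′} {P} {e} prP′ prP _ 1≤e P′<P 2+e≤P′ =
        subst₂ (λ P e → 5 * (P + e) ≤ 2 * ((2 + e) * P)) (m+[n∸m]≡n 5≤P) (m+[n∸m]≡n 1≤e)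
          (arith (e ∸ 1) (P ∸ 5))
        where
        3≤P′ : 3 ≤ P′
        3≤P′ = ≤-trans (s≤s (s≤s 1≤e)) 2+e≤P′
        5≤P : 5 ≤ P
        5≤P = ≤-trans (s≤s (s≤s 3≤P′)) (odd-prime-gap prP′ prP 3≤P′ P′<P)

    -- For the reverse inequality in the exceptional case. The general bound yields only the factor
    -- 4; the factor 5 is sharp, as {2, 3} against {2, 3, 5} shows.
    product≤primorial-excess4 : ∀ {b qs} → PrimesBelow b qs → sum qs + 4 ≤ Σπ (suc (length qs)) →
      5 * product qs ≤ primorial (suc (length qs))
    product≤primorial-excess4 {qs = qs} dec le = subst (5 * product qs ≤_) (*-identityˡ _)
      (refined-product≤primorial 4 5 1 base step dec le (inj₂ (s≤s (s≤s (s≤s z≤n)))))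
      where
      base : ∀ {P} → Prime P → 3 ≤ P → 4 ≤ P → 5 ≤ 1 * P
      base {P} prP _ 4≤P = subst (5 ≤_) (sym (*-identityˡ P)) (prime≥-next 4 (from-no (prime? 4)) prP 4≤P)
      arith₂ : ∀ P → 5 * ((10 + P) + 2) ≤ 1 * (6 * (10 + P))
      arith₂ P = subst (5 * ((10 + P) + 2) ≤_) (lem P) (m≤m+n _ P)
        where
        lem : ∀ P → 5 * ((10 + P) + 2) + P ≡ 1 * (6 * (10 + P))
        lem = solve-∀
      arith₃ : ∀ e P → 5 * ((8 + P) + (3 + e)) ≤ 1 * ((7 + e) * (8 + P))
      arith₃ e P = subst (5 * ((8 + P) + (3 + e)) ≤_) (lem e P) (m≤m+n _ (1 + 3 * e + 2 * P + e * P))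
        where
        lem : ∀ e P → 5 * ((8 + P) + (3 + e)) + (1 + 3 * e + 2 * P + e * P) ≡ 1 * ((7 + e) * (8 + P))
        lem = solve-∀
      step : ∀ {P′ P e} → Prime P′ → Prime P → Prime (P + e) → 1 ≤ e → P′ < P → 4 + e ≤ P′ →
        5 * (P + e) ≤ 1 * ((4 + e) * P)
      step {P′} {P} {e} prP′ prP prQ 1≤e P′<P 4+e≤P′ = cases (m≤n⇒m<n∨m≡n 2≤e)
        where
        4≤P′ : 4 ≤ P′
        4≤P′ = ≤-trans (m≤m+n 4 e) 4+e≤P′
        3≤P′ : 3 ≤ P′
        3≤P′ = <⇒≤ 4≤P′
        2≤e : 2 ≤ e
        2≤e = +-cancelˡ-≤ P 2 e (subst (_≤ P + e) (+-comm 2 P)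
          (odd-prime-gap prP prQ (≤-trans 3≤P′ (<⇒≤ P′<P)) (m<m+n P 1≤e)))
        7≤P′ : 7 ≤ P′
        7≤P′ = prime≥-next 6 (from-no (prime? 6)) prP′ (≤-trans (+-monoʳ-≤ 4 2≤e) 4+e≤P′)
        -- Needed for `e = 2`, where the claim is `5 * (P + 2) ≤ 6 * P`. Skipping the composite
        -- numbers 6 and 9 just reaches it: `P′ ≥ 7`, so `P ≥ 9`, so `P ≥ 10`.
        10≤P : 10 ≤ P
        10≤P = prime≥-next 9 (from-no (prime? 9)) prP
          (≤-trans (s≤s (s≤s 7≤P′)) (odd-prime-gap prP′ prP 3≤P′ P′<P))
        cases : 2 < e ⊎ 2 ≡ e → 5 * (P + e) ≤ 1 * ((4 + e) * P)
        cases (inj₂ refl) = subst (λ P → 5 * (P + 2) ≤ 1 * (6 * P)) (m+[n∸m]≡n 10≤P) (arith₂ (P ∸ 10))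
        cases (inj₁ 3≤e)  = subst₂ (λ P e → 5 * (P + e) ≤ 1 * ((4 + e) * P))
          (m+[n∸m]≡n (≤-trans (from-yes (8 ≤? 10)) 10≤P)) (m+[n∸m]≡n 3≤e) (arith₃ (e ∸ 3) (P ∸ 8))

    -- The budget for the new largest element is y = n - Σπ m, and `q` overshoots it by D ≥ 1. The
    -- sum of `qs` is then at least D below `Σπ m`, so passing from `qs` to the first m primes makes
    -- up for the passage from `q` to `R`.
    extend-near-initial : ∀ n q {qs} → PrimesBelow q qs → 2 ∈ qs → q + sum qs ≤ n →
      Σπ (2 + length qs) ≤ n → n < Σπ (suc (length qs)) + q → StrictExtension q n (q ∷ qs)
    extend-near-initial n q {qs} dec 2∈ sum≤n Σ≤n n< with largestPrime≤-close y 2≤y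
      where
      m = suc (length qs)
      y = n ∸ Σπ m
      2≤y : 2 ≤ y
      2≤y = ≤-trans (prime≥2 (π-prime m))
        (subst (_≤ y) (m+n∸m≡n (Σπ m) (π (suc m))) (∸-monoˡ-≤ (Σπ m) Σ≤n))
    ... | R , prR , R≤y , greatest , close =
      R ∷ initial m
      , cons prR (≤-<-trans R≤y y<q) (PrimesBelow-mono (≤-trans (π-< m) p≤R) (initial-below m))
      , cong suc (length-initial m)
      , subst₂ _≤_ (trans (+-comm (Σπ m) R) (cong (R +_) (sym (sum-initial m)))) n≡ (+-monoʳ-≤ (Σπ m) R≤y)
      , strict D (m+[n∸m]≡n (<⇒≤ y<q)) 1≤D sum+D≤
      where
      m = suc (length qs)
      y = n ∸ Σπ m
      D = q ∸ y
      n≡ : Σπ m + y ≡ n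
      n≡ = m+[n∸m]≡n (≤-trans (m≤m+n (Σπ m) (π (suc m))) Σ≤n)
      y<q : y < q
      y<q = +-cancelˡ-< (Σπ m) y q (subst (_< Σπ m + q) (sym n≡) n<)
      1≤D : 1 ≤ D
      1≤D = m<n⇒0<n∸m y<q
      p≤y : π (suc m) ≤ y
      p≤y = +-cancelˡ-≤ (Σπ m) (π (suc m)) y (subst (Σπ (suc m) ≤_) (sym n≡) Σ≤n)
      p≤R : π (suc m) ≤ R
      p≤R = greatest (π-prime m) p≤y
      2≤m : ∀ {qs} → 2 ∈ qs → 2 ≤ suc (length qs)
      2≤m {_ ∷ _} _ = s≤s (s≤s z≤n)
      -- `2 ∈ qs` makes `qs` non-empty, so `R` is at least the third prime.
      5≤R : 5 ≤ R
      5≤R = ≤-trans (subst (_≤ π (suc m)) π₃≡5 (π-mono-≤ {3} (s≤s (2≤m 2∈)))) p≤R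
      sum+D≤ : sum qs + D ≤ Σπ m
      sum+D≤ = +-cancelʳ-≤ y (sum qs + D) (Σπ m) (begin
        sum qs + D + y     ≡⟨ +-assoc (sum qs) D y ⟩
        sum qs + (D + y)   ≡⟨ cong (sum qs +_) (m∸n+n≡m (<⇒≤ y<q)) ⟩
        sum qs + q         ≡⟨ +-comm (sum qs) q ⟩
        q + sum qs         ≤⟨ sum≤n ⟩
        n                  ≡⟨ n≡ ⟨
        Σπ m + y           ∎)
        where open ≤-Reasoning
      strict : ∀ D → y + D ≡ q → 1 ≤ D → sum qs + D ≤ Σπ m →
        6 * (q * product qs) < 5 * (R * primorial m)
      strict 1 refl _ le = exchange-excess1 y R (product qs) (primorial m) close 5≤R (primorial≥1 m)
        (product≤primorial-excess1 dec le 2∈)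
      strict 2 refl _ le = exchange-excess2 y R (product qs) (primorial m) close 5≤R (primorial≥1 m)
        (product≤primorial-excess2 dec le 2∈)
      strict (suc (suc (suc d))) refl _ le = exchange-excess≥3 d y R (product qs) (primorial m) close 5≤R
        (primorial≥1 m) (excess*product≤primorial (3 + d) dec le)

    6*initial<5*initial : ∀ m → 6 * primorial m < 5 * (π (suc m) * primorial m)
    6*initial<5*initial m = begin-strict
      6 * primorial m                    <⟨ *-monoˡ-< (primorial m) {{>-nonZero (primorial≥1 m)}} (from-yes (6 <? 10)) ⟩
      5 * 2 * primorial m                ≡⟨ *-assoc 5 2 (primorial m) ⟩
      5 * (2 * primorial m)              ≤⟨ *-monoʳ-≤ 5 (*-monoˡ-≤ (primorial m) (prime≥2 (π-prime m))) ⟩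
      5 * (π (suc m) * primorial m)      ∎
      where open ≤-Reasoning

    2∈tail : ∀ {i q qs} → ¬ q ≤ π (suc i) → 2 ∈ q ∷ qs → 2 ∈ qs
    2∈tail {i} q≰p = Any.tail λ { refl → q≰p (prime≥2 (π-prime i)) }

    -- The bound `b` plays the part of the element discarded last. Its excess over the prime of
    -- index one more than the length leaves room below it for an initial set; the tail inherits
    -- this property with `q` as bound when `q` is not yet the last initial prime.
    extend-even : ∀ n {b qs} → PrimesBelow b qs → π (suc (length qs)) < b → 2 ∈ qs → sum qs ≤ n →
      Σπ (suc (length qs)) ≤ n → StrictExtension b n qs
    extend-even n {b} {q ∷ qs} dec@(cons pr q<b dec′) p<b 2∈ sum≤n Σ≤n
      with q ≤? π (suc (length qs))
    ... | yes q≤p = initial (suc m)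
      , PrimesBelow-mono p<b (initial-below (suc m))
      , cong suc (length-initial m)
      , subst (_≤ n) (sym (sum-initial (suc m))) Σ≤n
      , subst (λ xs → 6 * product xs < 5 * primorial (suc m))
          (sym (initial-of-small-head dec (≤-<-trans q≤p (π-< m)))) (6*initial<5*initial m)
      where m = suc (length qs)
    ... | no q≰p with Σπ (suc (length qs)) + q ≤? n
    ...   | no Σ+q≰n = let T , dec-T , rest = extend-near-initial n q dec′ (2∈tail q≰p 2∈) sum≤n Σ≤n (≰⇒> Σ+q≰n) in
      T , PrimesBelow-mono (<⇒≤ q<b) dec-T , rest
    ...   | yes Σ+q≤n with extend-even (n ∸ q) dec′ (≰⇒> q≰p) (2∈tail q≰p 2∈) 
           (m+n≤o⇒m≤o∸n (sum qs) (subst (_≤ n) (+-comm q (sum qs)) sum≤n))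
           (m+n≤o⇒m≤o∸n (Σπ (suc (length qs))) Σ+q≤n)
    ...     | T , dec-T , len , sum-T , strict = q ∷ T , cons pr q<b dec-T , cong suc len
      , subst (q + sum T ≤_) (m+[n∸m]≡n (≤-trans (m≤n+m q _) Σ+q≤n)) (+-monoʳ-≤ q sum-T)
      , subst₂ _<_ (x∙yz≈y∙xz q 6 (product qs)) (x∙yz≈y∙xz q 5 (product T)) (*-monoʳ-< q {{prime⇒nonZero pr}} strict)

    -- In the last two cases S consists of π 2, …, π (m + 1) and of π 3, …, π (m + 2)
    -- respectively, where m = length S.
    data OddCase (b : ℕ) (S : List ℕ) : Set where
      extensible  : StrictExtension b (sum S) S → OddCase b S
      allBut2     : PrimesBelow (suc (π (suc (length S)))) S → sum S + 2 ≡ Σπ (suc (length S)) → OddCase b S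
      allBut2And3 : PrimesBelow (suc (π (2 + length S))) S → (∀ {c} → PrimesBelow c S → π (2 + length S) < c) →
        sum S + 5 ≡ Σπ (2 + length S) → 1 ≤ length S →
        ∀ T → PrimesBelow b T → length T ≡ suc (length S) → sum T ≡ sum S → 6 * product S ≡ 5 * product T →
        OddCase b S

    -- Induction from the smallest element upwards. Extensibility passes from the tail to the whole
    -- set. Otherwise the tail is one of the two special sets; then `q` is the next prime and
    -- continues it, or a prime was skipped and `exchange-for-2` applies. The exception is `q = 5`
    -- on the empty tail, which starts the second family.
    oddCase : ∀ {b S} → PrimesBelow b S → ¬ 2 ∈ S → OddCase b S
    oddCase [] _ = allBut2 [] (sym π₁≡2)
    oddCase {b} {q ∷ S} (cons pr q<b dec) 2∉ with oddCase dec (∉-tail 2∉)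
    ... | extensible (T , dec-T , len , sum-T , strict) = extensible
      (q ∷ T , cons pr q<b dec-T , cong suc len , +-monoʳ-≤ q sum-T
      , subst₂ _<_ (x∙yz≈y∙xz q 6 (product S)) (x∙yz≈y∙xz q 5 (product T)) (*-monoʳ-< q {{prime⇒nonZero pr}} strict))
    ... | allBut2 below sum≡ with q ≟ π (2 + length S)
    ...   | yes refl = allBut2 (cons pr ≤-refl (PrimesBelow-mono (π-< (suc (length S))) below))
      (trans (lem q (sum S)) (cong (_+ q) sum≡))
      where
      lem : ∀ q s → q + s + 2 ≡ s + 2 + q
      lem = solve-∀
    ...   | no q≢p = beyond (≤∧≢⇒< p≤q λ p≡q → q≢p (sym p≡q))
      where
      2<q : 2 < q
      2<q = ≤∧≢⇒< (prime≥2 pr) λ 2≡q → 2∉ (here 2≡q)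
      p≤q : π (2 + length S) ≤ q
      p≤q = subst (λ l → π (suc l) ≤ q) (length-snoc-2 S) (π≤head (cons pr q<b (snoc-2 dec (∉-tail 2∉) 2<q)))
      beyond : π (2 + length S) < q → OddCase b (q ∷ S)
      beyond p<q with q ≟ 5
      ... | yes refl = only5 S p<q below
        where
        only5 : ∀ S → π (2 + length S) < 5 → PrimesBelow (suc (π (suc (length S)))) S → OddCase b (5 ∷ S)
        only5 (_ ∷ S) p<5 _ = contradiction p<5
          (≤⇒≯ (subst (_≤ π (3 + length S)) π₃≡5 (π-mono-≤ {3} (s≤s (s≤s (s≤s z≤n))))))
        only5 [] _ _ = allBut2And3 (cons pr (s≤s (≤-reflexive (sym π₃≡5))) [])
          (λ { (cons _ 5<c _) → subst (_< _) (sym π₃≡5) 5<c })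
          (sym (trans (cong (_+ π 3) (cong₂ _+_ π₁≡2 π₂≡3)) (cong (5 +_) π₃≡5))) ≤-refl
          (3 ∷ 2 ∷ []) (cons (from-yes (prime? 3)) (<-trans (from-yes (3 <? 5)) q<b) (cons prime[2] ≤-refl []))
          refl refl refl
      ... | no q≢5 with largestPrime≤-close (q ∸ 1) (∸-monoˡ-≤ 1 2<q)
      ...   | r , prr , r≤ , greatest , close = extensible (exchange-for-2 pr q<b prr
        (≤-trans (subst (_≤ π (2 + length S)) π₂≡3 (π-mono-≤ {2} (s≤s (s≤s z≤n)))) p≤r)
        (≤-trans (s≤s r≤) (≤-reflexive 1+q∸1)) (subst (λ z → 3 * z ≤ 5 * r) 1+q∸1 close) q≢5
        (PrimesBelow-mono (≤-trans (π-< (suc (length S))) p≤r) below) (∉-tail 2∉))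
        where
        1+q∸1 : suc (q ∸ 1) ≡ q
        1+q∸1 = m+[n∸m]≡n (prime≥1 pr)
        p≤r : π (2 + length S) ≤ r
        p≤r = greatest (π-prime (suc (length S))) (∸-monoˡ-≤ 1 p<q)
    oddCase {b} {q ∷ S} (cons pr q<b dec) 2∉
      | allBut2And3 below above sum≡ 1≤len T dec-T len sum-T prod with q ≟ π (3 + length S)
    ... | yes refl = allBut2And3 (cons pr ≤-refl (PrimesBelow-mono (π-< (2 + length S)) below))
      (λ { (cons _ q<c _) → q<c }) (trans (lem q (sum S)) (cong (_+ q) sum≡)) (s≤s z≤n)
      (q ∷ T) (cons pr q<b dec-T) (cong suc len) (cong (q +_) sum-T)
      (trans (x∙yz≈y∙xz 6 q (product S)) (trans (cong (q *_) prod) (x∙yz≈y∙xz q 5 (product T))))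
      where
      lem : ∀ q s → q + s + 5 ≡ s + 5 + q
      lem = solve-∀
    ... | no q≢p with largestPrime≤-close (q ∸ 1) (∸-monoˡ-≤ 1 2<q)
      where
      2<q : 2 < q
      2<q = ≤∧≢⇒< (prime≥2 pr) λ 2≡q → 2∉ (here 2≡q)
    ...   | r , prr , r≤ , greatest , close = extensible (exchange-for-2 pr q<b prr
      (≤-trans (from-yes (3 ≤? 5)) 5≤r)
      (≤-trans (s≤s r≤) (≤-reflexive 1+q∸1)) (subst (λ z → 3 * z ≤ 5 * r) 1+q∸1 close)
      (λ { refl → <⇒≱ p<q 5≤p })
      (PrimesBelow-mono (≤-trans (π-< (2 + length S)) p≤r) below) (∉-tail 2∉))
      where
      1+q∸1 : suc (q ∸ 1) ≡ q
      1+q∸1 = m+[n∸m]≡n (prime≥1 pr)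
      p<q : π (3 + length S) < q
      p<q = ≤∧≢⇒< (π-least (2 + length S) pr (above dec)) λ p≡q → q≢p (sym p≡q)
      p≤r : π (3 + length S) ≤ r
      p≤r = greatest (π-prime (2 + length S)) (∸-monoˡ-≤ 1 p<q)
      5≤p : 5 ≤ π (3 + length S)
      5≤p = subst (_≤ π (3 + length S)) π₃≡5 (π-mono-≤ {3} (s≤s (s≤s (s≤s z≤n))))
      5≤r : 5 ≤ r
      5≤r = ≤-trans 5≤p p≤r

    -- Comparison of consecutive maxima

    Exceptional : ℕ → ℕ → Set
    Exceptional n m = 1 ≤ m × (n + 4 ≡ Σπ (2 + m) ⊎ n + 5 ≡ Σπ (2 + m))

    TightExtension : ℕ → ℕ → List ℕ → Set
    TightExtension b n S = ∃ λ T →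
      PrimesBelow b T × length T ≡ suc (length S) × sum T ≤ n × 6 * product S ≡ 5 * product T

    StrictExtension-mono : ∀ {b m n} S → m ≤ n → StrictExtension b m S → StrictExtension b n S
    StrictExtension-mono _ m≤n (T , dec , len , sum≤ , strict) = T , dec , len , ≤-trans sum≤ m≤n , strict

    extend-by-2 : ∀ {b n S} → PrimesBelow b S → ¬ 2 ∈ S → sum S + 2 ≤ n → StrictExtension (3 ⊔ b) n S
    extend-by-2 {b} {n} {S} dec 2∉ sum≤ = S ++ [ 2 ]
      , snoc-2 (PrimesBelow-mono (m≤n⊔m 3 b) dec) 2∉ (m≤m⊔n 3 b)
      , length-snoc-2 S
      , subst (_≤ n) (sym (sum-++ S [ 2 ])) sum≤
      , (begin-strict
        6 * product S                   <⟨ *-monoˡ-< (product S) {{>-nonZero (product≥1 dec)}} (from-yes (6 <? 10)) ⟩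
        10 * product S                  ≡⟨ lem (product S) ⟩
        5 * (product S * 2)             ≡⟨ cong (5 *_) (product-++ S [ 2 ]) ⟨
        5 * product (S ++ [ 2 ])        ∎)
      where
      open ≤-Reasoning
      lem : ∀ s → 10 * s ≡ 5 * (s * 2)
      lem = solve-∀

    Extension : ℕ → List ℕ → Set
    Extension n S =
      (∃ λ c → StrictExtension c n S) ⊎ (Exceptional n (length S) × ∃ λ c → TightExtension c n S)

    extension : ∀ n {b S} → PrimesBelow b S → sum S ≤ n → Σπ (suc (length S)) ≤ n → Extension n S
    extension n {b} {S} dec sum≤n Σ≤n with 2 ∈? S
    ... | yes 2∈ = inj₁ (c , extend-even n (PrimesBelow-mono (m≤n⊔m (suc P) b) dec) (m≤m⊔n (suc P) b) 2∈ sum≤n Σ≤n)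
      where
      P = π (suc (length S))
      c = suc P ⊔ b
    ... | no 2∉ with oddCase dec 2∉
    ...   | extensible ext     = inj₁ (b , StrictExtension-mono S sum≤n ext)
    ...   | allBut2 _ sum≡     = inj₁ (3 ⊔ b , extend-by-2 dec 2∉ (≤-trans (≤-reflexive sum≡) Σ≤n))
    ...   | allBut2And3 _ _ sum≡ 1≤len T dec-T len sum-T prod = cases (n ∸ sum S) (m+[n∸m]≡n sum≤n)
      where
      tight : ∃ λ c → TightExtension c n S
      tight = b , T , dec-T , len , ≤-trans (≤-reflexive sum-T) sum≤n , prod
      lem : ∀ s → s + 1 + 4 ≡ s + 5
      lem = solve-∀
      -- Slack 0 and 1 are the two exceptional values of `n`; with slack at least 2 the prime 2 is
      -- simply added.
      cases : ∀ d → sum S + d ≡ n → Extension n S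
      cases 0 refl = inj₂ ((1≤len , inj₂ (trans (cong (_+ 5) (+-identityʳ (sum S))) sum≡)) , tight)
      cases 1 refl = inj₂ ((1≤len , inj₁ (trans (lem (sum S)) sum≡)) , tight)
      cases (suc (suc d)) refl = inj₁ (3 ⊔ b , extend-by-2 dec 2∉ (+-monoʳ-≤ (sum S) (s≤s (s≤s z≤n))))

    initialBut2And3 : ℕ → List ℕ
    initialBut2And3 zero    = []
    initialBut2And3 (suc i) = π (3 + i) ∷ initialBut2And3 i

    initialBut2And3-below : ∀ i → PrimesBelow (suc (π (2 + i))) (initialBut2And3 i)
    initialBut2And3-below zero    = []
    initialBut2And3-below (suc i) =
      cons (π-prime (2 + i)) ≤-refl (PrimesBelow-mono (π-< (2 + i)) (initialBut2And3-below i))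

    length-initialBut2And3 : ∀ i → length (initialBut2And3 i) ≡ i
    length-initialBut2And3 zero    = refl
    length-initialBut2And3 (suc i) = cong suc (length-initialBut2And3 i)

    sum-initialBut2And3 : ∀ i → sum (initialBut2And3 i) + 5 ≡ Σπ (2 + i)
    sum-initialBut2And3 zero    = sym (cong₂ _+_ π₁≡2 π₂≡3)
    sum-initialBut2And3 (suc i) =
      trans (lem (π (3 + i)) (sum (initialBut2And3 i))) (cong (_+ π (3 + i)) (sum-initialBut2And3 i))
      where
      lem : ∀ q s → q + s + 5 ≡ s + 5 + q
      lem = solve-∀

    product-initialBut2And3 : ∀ i → 6 * product (initialBut2And3 i) ≡ primorial (2 + i)
    product-initialBut2And3 zero    = sym (cong₂ (λ q r → q * (r * 1)) π₂≡3 π₁≡2)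
    product-initialBut2And3 (suc i) =
      trans (x∙yz≈y∙xz 6 (π (3 + i)) (product (initialBut2And3 i))) (cong (π (3 + i) *_) (product-initialBut2And3 i))

    exceptional⇒≤ : ∀ {n i} → Exceptional n i → Σπ (2 + i) ≤ n + 5 × n + 4 ≤ Σπ (2 + i)
    exceptional⇒≤ {n} (_ , inj₁ eq) = ≤-trans (≤-reflexive (sym eq)) (+-monoʳ-≤ n (n≤1+n 4)) , ≤-reflexive eq
    exceptional⇒≤ {n} (_ , inj₂ eq) = ≤-reflexive (sym eq) , ≤-trans (+-monoʳ-≤ n (n≤1+n 4)) (≤-reflexive eq)

    -- Stated for arbitrary maxima, so that the search behind `h` is never unfolded. Extending the
    -- set behind `a` gives the inequality, strictly unless the case is exceptional. In that case
    -- {p₃, ..., pᵢ₊₂} fits, and its product is a sixth of the primorial that bounds `5 * b`.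
    consecutive-maxima : ∀ {n i a b} → Σπ (suc i) ≤ n →
      IsMaximum (Admissible i n) a → IsMaximum (Admissible (suc i) n) b →
      6 * a ≤ 5 * b × (6 * a ≡ 5 * b ⇔ Exceptional n i)
    consecutive-maxima {n} {i} {a} {b} Σ≤n (adm-a , a-max) (adm-b , b-max) =
      proj₁ forward , mk⇔ (proj₂ forward) backward
      where
      bounded : ∀ {c} T → PrimesBelow c T → length T ≡ suc i → sum T ≤ n → product T ≤ b
      bounded T dec len sum≤n = b-max (subst (λ l → Admissible l n (product T)) len (product-admissible dec sum≤n))

      forward : 6 * a ≤ 5 * b × (6 * a ≡ 5 * b → Exceptional n i)
      forward with admissible⇒primes adm-a
      ... | _ , S , dec , refl , sum≤n , refl with extension n dec sum≤n Σ≤n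
      ...   | inj₁ (_ , T , dec-T , len , sum-T , 6S<5T) =
        <⇒≤ 6S<5b , λ eq → contradiction eq (<⇒≢ 6S<5b)
        where
        6S<5b : 6 * product S < 5 * b
        6S<5b = <-≤-trans 6S<5T (*-monoʳ-≤ 5 (bounded T dec-T len sum-T))
      ...   | inj₂ (exceptional , _ , T , dec-T , len , sum-T , 6S≡5T) =
        ≤-trans (≤-reflexive 6S≡5T) (*-monoʳ-≤ 5 (bounded T dec-T len sum-T)) , λ _ → exceptional

      backward : Exceptional n i → 6 * a ≡ 5 * b
      backward exc with exceptional⇒≤ exc | admissible⇒primes adm-b
      ... | Σ≤n+5 , n+4≤Σ | _ , T , dec , len , sum≤n , refl = ≤-antisym (proj₁ forward) (begin
        5 * product T                       ≤⟨ product≤primorial-excess4 dec sum+4≤ ⟩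
        primorial (suc (length T))          ≡⟨ cong (λ l → primorial (suc l)) len ⟩
        primorial (2 + i)                   ≡⟨ product-initialBut2And3 i ⟨
        6 * product (initialBut2And3 i)     ≤⟨ *-monoʳ-≤ 6 (a-max witness) ⟩
        6 * a                               ∎)
        where
        open ≤-Reasoning
        sum+4≤ : sum T + 4 ≤ Σπ (suc (length T))
        sum+4≤ = subst (λ l → sum T + 4 ≤ Σπ (suc l)) (sym len) (≤-trans (+-monoˡ-≤ 4 sum≤n) n+4≤Σ)
        witness : Admissible i n (product (initialBut2And3 i))
        witness = subst (λ l → Admissible l n (product (initialBut2And3 i))) (length-initialBut2And3 i)
          (product-admissible (initialBut2And3-below i)
            (+-cancelʳ-≤ 5 _ n (subst (_≤ n + 5) (sym (sum-initialBut2And3 i)) Σ≤n+5)))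

  -- The result for the primes p and the maxima h

  p-isNext : ∀ i → IsNextPrime (p i) (p (suc i))
  p-isNext i = proj₂ (nextPrime (p i))

  open Enumeration p refl refl refl (λ i → proj₁ (p-isNext i))
    (λ i → proj₁ (proj₂ (p-isNext i))) (λ i → proj₂ (proj₂ (p-isNext i)))

  Σπ≡σ : ∀ j → Σπ j ≡ σ j
  Σπ≡σ zero    = refl
  Σπ≡σ (suc j) = cong (_+ p (suc j)) (Σπ≡σ j)

  σ-mono-≤ : ∀ {i j} → i ≤ j → σ i ≤ σ j
  σ-mono-≤ {i} {j} i≤j = subst₂ _≤_ (Σπ≡σ i) (Σπ≡σ j) (Σπ-mono-≤ i≤j)

  h-consecutive : ∀ n k i → σ k ≤ n → suc i ≤ k →
    6 * h i n ≤ 5 * h (suc i) n ×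
    (6 * h i n ≡ 5 * h (suc i) n ⇔ (suc i ≡ k × 2 ≤ k × (n + 4 ≡ σ (2 + i) ⊎ n + 5 ≡ σ (2 + i))))
  h-consecutive n k i σk≤n 1+i≤k =
    proj₁ maxima , mk⇔ to from ⇔-∘ proj₂ maxima
    where
    σ[1+i]≤n : σ (suc i) ≤ n
    σ[1+i]≤n = ≤-trans (σ-mono-≤ 1+i≤k) σk≤n
    maxima = consecutive-maxima (subst (_≤ n) (sym (Σπ≡σ (suc i))) σ[1+i]≤n)
      (h-isMaximum (≤-trans (σ-mono-≤ (n≤1+n i)) σ[1+i]≤n)) (h-isMaximum σ[1+i]≤n)
    -- `σ (2 + i)` exceeds `n`, which is at least `σ k`, so `2 + i ≤ k` is impossible.
    1+i≡k : ∀ d → n + d ≡ σ (2 + i) → 0 < d → suc i ≡ k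
    1+i≡k d eq 0<d = ≤-antisym 1+i≤k (s≤s⁻¹ (≰⇒> λ 2+i≤k →
      <⇒≱ (m<m+n n 0<d) (≤-trans (≤-reflexive eq) (≤-trans (σ-mono-≤ 2+i≤k) σk≤n))))
    to : Exceptional n i → suc i ≡ k × 2 ≤ k × (n + 4 ≡ σ (2 + i) ⊎ n + 5 ≡ σ (2 + i))
    to (1≤i , inj₁ eq) = let eq′ = trans eq (Σπ≡σ (2 + i)); j≡k = 1+i≡k 4 eq′ z<s in
      j≡k , ≤-trans (s≤s 1≤i) (≤-reflexive j≡k) , inj₁ eq′
    to (1≤i , inj₂ eq) = let eq′ = trans eq (Σπ≡σ (2 + i)); j≡k = 1+i≡k 5 eq′ z<s in
      j≡k , ≤-trans (s≤s 1≤i) (≤-reflexive j≡k) , inj₂ eq′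
    from : suc i ≡ k × 2 ≤ k × (n + 4 ≡ σ (2 + i) ⊎ n + 5 ≡ σ (2 + i)) → Exceptional n i
    from (refl , s≤s 1≤i , inj₁ eq) = 1≤i , inj₁ (trans eq (sym (Σπ≡σ (2 + i))))
    from (refl , s≤s 1≤i , inj₂ eq) = 1≤i , inj₂ (trans eq (sym (Σπ≡σ (2 + i))))

  -- Rational form

  5/6 : ℚ.ℚ
  5/6 = ℤ.+ 5 ℚ./ 6

  -- The unnormalised form avoids cancelling common factors. `mkℚᵘ` takes the denominator minus one,
  -- so the final 5 stands for 6.
  toℚᵘ-5/6* : ∀ b → ℚ.toℚᵘ (5/6 ℚ.* fromℤ (ℤ.+ b)) ℚᵘ.≃ ℚᵘ.mkℚᵘ (ℤ.+ (5 * b)) 5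
  toℚᵘ-5/6* b = ℚᵘ.≃-trans (ℚ.toℚᵘ-homo-* 5/6 (fromℤ (ℤ.+ b)))
    (ℚᵘ.*≡* (cong (ℤ._* ℤ.+ 6) (sym (ℤ.pos-* 5 b))))

  ≤5/6* : ∀ a b → 6 * a ≤ 5 * b → fromℤ (ℤ.+ a) ℚ.≤ 5/6 ℚ.* fromℤ (ℤ.+ b)
  ≤5/6* a b le = ℚ.toℚᵘ-cancel-≤ (ℚᵘ.≤-respʳ-≃ (ℚᵘ.≃-sym (toℚᵘ-5/6* b)) (ℚᵘ.*≤*
    (subst₂ ℤ._≤_ (trans (cong ℤ.+_ (*-comm 6 a)) (ℤ.pos-* a 6)) (sym (ℤ.*-identityʳ (ℤ.+ (5 * b)))) (ℤ.+≤+ le))))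

  ≡5/6*⇔ : ∀ a b → (fromℤ (ℤ.+ a) ≡ 5/6 ℚ.* fromℤ (ℤ.+ b)) ⇔ (6 * a ≡ 5 * b)
  ≡5/6*⇔ a b = mk⇔ to from
    where
    lhs : ℤ.+ a ℤ.* ℤ.+ 6 ≡ ℤ.+ (6 * a)
    lhs = trans (sym (ℤ.pos-* a 6)) (cong ℤ.+_ (*-comm a 6))
    to : fromℤ (ℤ.+ a) ≡ 5/6 ℚ.* fromℤ (ℤ.+ b) → 6 * a ≡ 5 * b
    to eq with ℚᵘ.≃-trans (ℚ.toℚᵘ-cong eq) (toℚᵘ-5/6* b)
    ... | ℚᵘ.*≡* eq′ = ℤ.+-injective (trans (sym lhs) (trans eq′ (ℤ.*-identityʳ (ℤ.+ (5 * b)))))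
    from : 6 * a ≡ 5 * b → fromℤ (ℤ.+ a) ≡ 5/6 ℚ.* fromℤ (ℤ.+ b)
    from eq = ℚ.toℚᵘ-injective (ℚᵘ.≃-trans
      (ℚᵘ.*≡* (trans lhs (trans (cong ℤ.+_ eq) (sym (ℤ.*-identityʳ (ℤ.+ (5 * b)))))))
      (ℚᵘ.≃-sym (toℚᵘ-5/6* b)))

open import Data.Integer using (+_)
open import Data.Nat using (ℕ; suc; _+_; _∸_; _≤_; _<_)
open import Data.Product using (_×_; _,_; proj₁; proj₂)
open import Data.Rational using (ℚ; _/_; _*_) renaming (_≤_ to _≤ℚ_)
open import Data.Rational.Literals using (fromℤ)
open import Data.Sum using (_⊎_)
open import Function using (_⇔_)
open import Function.Construct.Composition using (_⇔-∘_)
open import Relation.Binary.PropositionalEquality using (_≡_)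
open Proof using (h-consecutive; ≤5/6*; ≡5/6*⇔)

theorem6p1 : ∀ (n : ℕ) → 2 ≤ n →
    ∀ (k : ℕ) → σ k ≤ n → n < σ (suc k) →
    ∀ (j : ℕ) → 1 ≤ j → j ≤ k →
    (fromℤ (+ h (j ∸ 1) n) ≤ℚ (+ 5 / 6) * fromℤ (+ h j n)) ×
    ((fromℤ (+ h (j ∸ 1) n) ≡ (+ 5 / 6) * fromℤ (+ h j n)) ⇔
    (j ≡ k × 2 ≤ k × (n + 4 ≡ σ (suc j) ⊎ n + 5 ≡ σ (suc j))))
theorem6p1 n _ k σk≤n _ (suc i) _ j≤k =
    ≤5/6* (h i n) (h (suc i) n) (proj₁ consecutive)
  , proj₂ consecutive ⇔-∘ ≡5/6*⇔ (h i n) (h (suc i) n)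
  where consecutive = h-consecutive n k i σk≤n j≤k
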